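{- Let $\varepsilon\le 1/6$ and let $G$ be a weighted graph, and consider a $\delta$-wide weight partition $[\ell_1,r_1),[\ell_2,r_2),\dots,[\ell_k,r_k)$. If $M_i$ is an arbitrary $(1-\varepsilon)$-approximate maximum weight matching on $G_{[\varepsilon\ell_i,\,r_i\varepsilon^{ -1})}$ for all $i\in\{1,\dots,k\}$, then $$\mu_w(M_1\cup M_2\cup\dots\cup M_k)\ \ge\ \big(1-O(\varepsilon\cdot\log_\delta(1/\varepsilon))\big)\cdot\mu_w(G).$$
   Context: $G=(V,E)$ is an undirected (not necessarily bipartite) graph with edge weights $w:E\to[1,W]$. A matching is a set of vertex-disjoint edges; $w(M)=\sum_{e\in M}w(e)$; $\mu_w(H)$ is the maximum of $w(M)$ over matchings $M$ in a subgraph (or edge set) $H$ of $G$. A $(1-\varepsilon)$-approximate maximum weight matching on $H$ is a matching $M\subseteq H$ with $w(M)\ge(1-\varepsilon)\mu_w(H)$. For $I\subseteq\mathbb{R}$, $G_I$ is the subgraph of $G$ restricted to the edges $e$ with $w(e)\in I$. Disjoint intervals $[\ell_1,r_1),\dots,[\ell_k,r_k)\subseteq\mathbb{R}$ form a weight partition if $\ell_{i+1}=r_i$ for all $1\le i\le k-1$ and the intervals cover $[1,W]$; they are $\delta$-wide if $r_i\ge\delta\cdot\ell_i$ for all $i\in\{1,\dots,k\}$. Here $\varepsilon>0$ and $\delta>1$.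
   Formalization: The error term is O(ε·max(1, log_δ(1/ε))) with an absolute constant, instead of O(ε·log_δ(1/ε)); the two agree for δ ≤ 1/ε, and for very large δ the printed bound fails already for k = 1. -}

module Defs where

open import Level using (0ℓ; suc)
open import Algebra.Apartness.Bundles using (HeytingField; HeytingCommutativeRing)
import Algebra.Definitions.RawSemiring as RawSemiring
open import Algebra.Bundles using (CommutativeRing; Semiring)
open import Data.Bool.Base using (if_then_else_)
open import Data.Fin.Base as Fin using (Fin; toℕ)
open import Data.Fin.Subset using (Subset; _∈_; ⋃)
open import Data.List.Base using (tabulate)
open import Data.Nat.Base as ℕ using (ℕ)
open import Data.Product.Base using (∃-syntax; _×_; proj₁; proj₂)
open import Data.Sum.Base using (_⊎_)
open import Data.Vec.Base using (lookup)
open import Function.Definitions using (Injective)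
open import Relation.Binary.Core using (Rel)
open import Relation.Binary.Lattice.Definitions using (Supremum)
open import Relation.Binary.PropositionalEquality.Core using (_≡_)
open import Relation.Binary.Structures using (IsStrictPartialOrder)
open import Relation.Nullary.Negation.Core using (¬_)
open import Relation.Unary using (Pred)

-- The real numbers, axiomatised as an Archimedean, Cauchy-complete ordered
-- field.  Order and apartness are not assumed decidable, so both the
-- constructive reals and, given excluded middle, the classical reals are
-- models.
record Reals : Set (suc 0ℓ) where
  field
    heytingField : HeytingField 0ℓ 0ℓ 0ℓ

  open HeytingField heytingField public

  open RawSemiring
    (Semiring.rawSemiring (CommutativeRing.semiring
      (HeytingCommutativeRing.commutativeRing heytingCommutativeRing))) public
    using (_^_; sum) renaming (_×_ to _·_)

  infix 4 _<_ _≤_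
  infixl 6 _⊔_

  field
    _<_                    : Rel Carrier 0ℓ
    <-isStrictPartialOrder : IsStrictPartialOrder _≈_ _<_
    <⇒#                    : ∀ {x y} → x < y → x # y
    #⇒<⊎>                  : ∀ {x y} → x # y → x < y ⊎ y < x
    +-monoˡ-<              : ∀ {x y} z → x < y → x + z < y + z
    *-pos                  : ∀ {x y} → 0# < x → 0# < y → 0# < x * y

  _≤_ : Rel Carrier 0ℓ
  x ≤ y = ¬ (y < x)

  field
    _⊔_         : Carrier → Carrier → Carrier
    ⊔-supremum  : Supremum _≤_ _⊔_
    archimedean : ∀ x → ∃[ n ] x < n · 1#

  IsCauchy : (ℕ → Carrier) → Set
  IsCauchy x = ∀ k → ∃[ N ] (∀ m n → N ℕ.≤ m → N ℕ.≤ n →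
    ℕ.suc k · (x m - x n) ≤ 1#)

  _ConvergesTo_ : (ℕ → Carrier) → Carrier → Set
  x ConvergesTo l = ∀ k → ∃[ N ] (∀ n → N ℕ.≤ n →
    ℕ.suc k · (x n - l) ≤ 1# × ℕ.suc k · (l - x n) ≤ 1#)

  field
    complete : ∀ x → IsCauchy x → ∃[ l ] x ConvergesTo l

  recip : ∀ x → 0# < x → Carrier
  recip x 0<x = proj₁ (#⇒invertible (#-sym (<⇒# 0<x)))

  _∈[_,_⟩ : Carrier → Carrier → Carrier → Set
  x ∈[ a , b ⟩ = a ≤ x × x < b

  -- z = b ^ y for real y and b > 1: z lies above bˢ for each rational s ≤ y
  -- and below bˢ for each rational s ≥ y.  Here s = (p - p′) / (1 + q), and
  -- the inequalities are cleared of roots and negative exponents.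
  IsPower : Carrier → Carrier → Carrier → Set
  IsPower b y z = ∀ p p′ q →
    (p · 1# ≤ ℕ.suc q · y + p′ · 1# → b ^ p ≤ z ^ ℕ.suc q * b ^ p′) ×
    (ℕ.suc q · y + p′ · 1# ≤ p · 1# → z ^ ℕ.suc q * b ^ p′ ≤ b ^ p)

  -- y = log_b x
  IsLog : Carrier → Carrier → Carrier → Set
  IsLog b x y = IsPower b y x


module WeightedMatching (ℝ : Reals) where
  open Reals ℝ

  -- A finite simple graph with edge weights in [1, W].  Each undirected edge
  -- is listed once, with its endpoints in increasing order.
  record WeightedGraph (W : Carrier) : Set where
    field
      #vertices #edges : ℕ

    Vertex : Set
    Vertex = Fin #vertices

    Edge : Set
    Edge = Fin #edges

    field
      ends      : Edge → Vertex × Vertex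
      ordered   : ∀ e → proj₁ (ends e) Fin.< proj₂ (ends e)
      simple    : Injective _≡_ _≡_ ends
      weight    : Edge → Carrier
      1≤weight  : ∀ e → 1# ≤ weight e
      weight≤W  : ∀ e → weight e ≤ W

    EdgeSet : Set
    EdgeSet = Subset #edges

    _EndpointOf_ : Vertex → Edge → Set
    v EndpointOf e = v ≡ proj₁ (ends e) ⊎ v ≡ proj₂ (ends e)

    IsMatching : EdgeSet → Set
    IsMatching M = ∀ e f v → e ∈ M → f ∈ M →
      v EndpointOf e → v EndpointOf f → e ≡ f

    w : EdgeSet → Carrier
    w M = sum (λ e → if lookup M e then weight e else 0#)

    -- Subgraphs are given by their edges, as a predicate: membership in
    -- G-restricted-to-an-interval is a comparison of reals, hence not
    -- decidable in general.
    Subgraph : Set₁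
    Subgraph = Pred Edge 0ℓ

    _MatchingIn_ : EdgeSet → Subgraph → Set
    M MatchingIn H = IsMatching M × (∀ e → e ∈ M → H e)

    -- m = μ_w(H).  Attainment is classical existence (¬ ¬ ∃), since a
    -- maximiser cannot be selected without deciding comparisons of reals.
    Isμ : Subgraph → Carrier → Set
    Isμ H m = (∀ M → M MatchingIn H → w M ≤ m) ×
              ¬ ¬ (∃[ M ] (M MatchingIn H × w M ≈ m))

    IsApproxMWM : Carrier → Subgraph → EdgeSet → Set
    IsApproxMWM ε H M = M MatchingIn H ×
      (∀ m → Isμ H m → (1# - ε) * m ≤ w M)

    Restrict : Carrier → Carrier → Subgraph
    Restrict a b e = weight e ∈[ a , b ⟩

    Union : ∀ {k} → (Fin k → EdgeSet) → Subgraph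
    Union M e = e ∈ ⋃ (tabulate M)

  record IsWeightPartition (W : Carrier) {k : ℕ} (ℓ r : Fin k → Carrier) : Set where
    field
      disjoint : ∀ i j x → x ∈[ ℓ i , r i ⟩ → x ∈[ ℓ j , r j ⟩ → i ≡ j
      adjacent : ∀ i j → toℕ j ≡ ℕ.suc (toℕ i) → ℓ j ≈ r i
      -- Classical existence again: locating x in an interval decides
      -- comparisons of reals.
      covers   : ∀ x → 1# ≤ x → x ≤ W → ¬ ¬ (∃[ i ] x ∈[ ℓ i , r i ⟩)

  IsWide : Carrier → {k : ℕ} → (ℓ r : Fin k → Carrier) → Set
  IsWide δ ℓ r = ∀ i → δ * ℓ i ≤ r i

-- All conclusions are negations, so comparisons of reals may be decided freely.
-- Start with an optimal matching N = M* and treat the classes from light to heavy.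
-- For class i, follow from both endpoints of every edge of N in the class the path
-- that alternates between M_i and the other edges of N in the window, until it
-- leaves the window or meets another class edge.  Paths not running into a heavier
-- edge of N are switched from N to M_i; class edges with a path running into one
-- are dropped (heavier edges of N still belong to M*), and so are lighter edges
-- touched by switched paths.  Near-optimality of M_i bounds the switching loss by
-- ε μ(window), lighter edges cost ε times the class edges that reach them, and
-- dropped class edges cost at most r_i.  By local optimality of M* each edge has a
-- neighbour in M* of at least half its weight, so everything is charged to M*: an
-- edge of weight y pays O(ε y) to each of the O(log_δ (1/ε)) windows around y, and
-- O(r_i) to lower classes, a geometric series with ratio δ.

module Submission where

open import Defs
open import Algebra.Apartness.Bundles using (HeytingCommutativeRing)
open import Algebra.Bundles using (CommutativeMonoid; CommutativeRing)
import Algebra.Apartness.Properties.HeytingCommutativeRing as HeytingProperties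
import Algebra.Properties.CommutativeMonoid.Sum as Sum
import Algebra.Properties.Monoid.Mult as MonoidMult
import Algebra.Properties.Ring as RingProperties
import Algebra.Properties.Semiring.Exp as SemiringExp
import Algebra.Properties.Semiring.Sum as SemiringSum
import Algebra.Solver.Ring.NaturalCoefficients.Default as Solver
open import Data.Bool.Base using (Bool; true; false; if_then_else_)
open import Data.Empty using (⊥; ⊥-elim)
open import Data.Fin.Base using (Fin; zero; suc; toℕ)
open import Data.Fin.Properties using (suc-injective)
open import Data.Fin.Subset using (Subset; inside; outside; _∈_; _∉_; _∪_; _─_; ⁅_⁆; ⋃) renaming (⊥ to ∅)
open import Data.Fin.Subset.Properties using (x∈⁅x⁆; x∈⁅y⁆⇒x≡y; x∈p∪q⁻; x∈p∪q⁺; p─q⊆p; x∈p∧x∉q⇒x∈p─q; ∉⊥; _∈?_)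
open import Data.List.Base using (tabulate)
open import Data.Nat.Base as ℕ using (ℕ)
open import Data.Nat.Properties using (<⇒≢)
open import Data.Product.Base using (∃-syntax; _×_; _,_; proj₁; proj₂)
open import Data.Sum.Base using (_⊎_; inj₁; inj₂)
open import Data.Unit.Base using (tt)
open import Data.Vec.Base using (lookup; []; _∷_; here; there)
open import Data.Vec.Properties using ([]=⇒lookup; lookup⇒[]=)
open import Function.Base using (_∘_)
open import Relation.Binary.PropositionalEquality.Core as ≡ using (_≡_; _≢_)
open import Relation.Binary.Structures using (IsPreorder; IsStrictPartialOrder)
import Relation.Binary.Reasoning.Base.Triple as Triple
open import Relation.Nullary.Decidable.Core using (Dec; yes; no; does; _⊎-dec_)
open import Relation.Nullary.Decidable using (¬¬-excluded-middle; decidable-stable)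
open import Relation.Nullary.Negation.Core using (¬_; contradiction)
open import Relation.Unary using (U)

-- Reasoning under double negation over finite index sets.

-- All goals reached through `do` are ⊥, so bind is mere application; the `where` alternatives of
-- its patterns carry out classical case distinctions.
_>>=_ : {A : Set} → ¬ ¬ A → ¬ A → ⊥
m >>= k = m k

-- Double-negation shift, which holds because the index set is finite.
¬¬-∀Fin : ∀ {n} {P : Fin n → Set} → (∀ i → ¬ ¬ P i) → ¬ ¬ (∀ i → P i)
¬¬-∀Fin {ℕ.zero}  h k = k λ ()
¬¬-∀Fin {ℕ.suc n} h k = do
  p  ← h zero
  ps ← ¬¬-∀Fin (h ∘ suc)
  k λ { zero → p ; (suc i) → ps i }

-- Weights are sums over a `Subset`, while the edge classes of the proof are predicates that cannot
-- be decided; under double negation membership may be settled index by index.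
comprehension : ∀ {n} (P : Fin n → Set) →
  ¬ ¬ (∃[ S ] ((∀ {i} → i ∈ S → P i) × (∀ {i} → P i → i ∈ S)))
comprehension {ℕ.zero}  P k = k ([] , (λ {i} → λ ()) , λ { {()} })
comprehension {ℕ.suc n} P k = do
  (S , sound , full) ← comprehension (P ∘ suc)
  yes p ← ¬¬-excluded-middle {A = P zero}
    where no ¬p → k (outside ∷ S , (λ { (there i∈S) → sound i∈S })
                                 , λ { {zero} p → contradiction p ¬p ; {suc i} p → there (full p) })
  k (inside ∷ S , (λ { here → p ; (there i∈S) → sound i∈S })
                , λ { {zero} p → here ; {suc i} p → there (full p) })

-- Ordered fields with an undecided order.

module OrderedField (ℝ : Reals) where
  open Reals ℝ hiding (zero)
  open HeytingProperties heytingCommutativeRing public using (1#0; x-0≈x)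
  private
    commutativeRing = HeytingCommutativeRing.commutativeRing heytingCommutativeRing
  open CommutativeRing commutativeRing public
    using (commutativeSemiring; semiring; ring; +-commutativeMonoid)
  open RingProperties ring using (-‿distribˡ-*; -‿involutive)
  open Solver commutativeSemiring public using (Polynomial; solve; _:=_; _:+_; _:*_; con)
  open Sum +-commutativeMonoid using (∑-distrib-+; ∑-comm; sum-cong-≋; sum-replicate-zero)
  open SemiringSum semiring using (*-distribˡ-sum)
  open SemiringExp semiring public using (^-homo-*)
  open MonoidMult (CommutativeMonoid.monoid +-commutativeMonoid) public using (×-homo-+)
  open IsStrictPartialOrder <-isStrictPartialOrder public
    using (<-resp-≈)
    renaming (irrefl to <-irrefl; trans to <-trans; asym to <-asym)

  -- con n denotes n ×′ 1#, which is not definitionally n · 1#.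
  numeral : ∀ {n} → ℕ → Polynomial n
  numeral ℕ.zero    = con 0
  numeral (ℕ.suc n) = con 1 :+ numeral n

  private variable
    x y z x′ y′ : Carrier
    m n : ℕ

  -- The substitute for trichotomy: as `≤` is a negation, the mixed transitivity laws of `<` and `≤`
  -- rest on this.
  <-cotrans : x < y → ∀ z → x < z ⊎ z < y
  <-cotrans x<y z with #-cotrans (<⇒# x<y) z
  <-cotrans x<y z | inj₁ x#z with #⇒<⊎> x#z
  ... | inj₁ x<z = inj₁ x<z
  ... | inj₂ z<x = inj₂ (<-trans z<x x<y)
  <-cotrans x<y z | inj₂ z#y with #⇒<⊎> z#y
  ... | inj₁ z<y = inj₂ z<y
  ... | inj₂ y<z = inj₁ (<-trans x<y y<z)

  ≤-reflexive : x ≈ y → x ≤ y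
  ≤-reflexive x≈y = <-irrefl (sym x≈y)

  ≤-refl : x ≤ x
  ≤-refl = ≤-reflexive refl

  <⇒≤ : x < y → x ≤ y
  <⇒≤ = <-asym

  <-≤-trans : x < y → y ≤ z → x < z
  <-≤-trans {z = z} x<y y≤z with <-cotrans x<y z
  ... | inj₁ x<z = x<z
  ... | inj₂ z<y = contradiction z<y y≤z

  ≤-<-trans : x ≤ y → y < z → x < z
  ≤-<-trans {x = x} x≤y y<z with <-cotrans y<z x
  ... | inj₁ y<x = contradiction y<x x≤y
  ... | inj₂ x<z = x<z

  ≤-trans : x ≤ y → y ≤ z → x ≤ z
  ≤-trans x≤y y≤z z<x = x≤y (≤-<-trans y≤z z<x)

  ≤-antisym : x ≤ y → y ≤ x → x ≈ y
  ≤-antisym {x} {y} x≤y y≤x = proj₁ (tight x y) λ x#y → case (#⇒<⊎> x#y)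
    where case : x < y ⊎ y < x → ⊥
          case (inj₁ x<y) = y≤x x<y
          case (inj₂ y<x) = x≤y y<x

  ≤-isPreorder : IsPreorder _≈_ _≤_
  ≤-isPreorder = record { isEquivalence = isEquivalence ; reflexive = ≤-reflexive ; trans = ≤-trans }

  module ≤-Reasoning where
    open Triple ≤-isPreorder <-asym <-trans <-resp-≈ <⇒≤ <-≤-trans ≤-<-trans public
      hiding (start; stop)

  open ≤-Reasoning

  +-cancelʳ-≤ : ∀ z → x + z ≤ y + z → x ≤ y
  +-cancelʳ-≤ z x+z≤y+z y<x = x+z≤y+z (+-monoˡ-< z y<x)

  +-cancelʳ-< : ∀ z → x + z < y + z → x < y
  +-cancelʳ-< {x} {y} z x+z<y+z = begin-strict
    x               ≈⟨ cancel x ⟨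
    x + z + (- z)   <⟨ +-monoˡ-< (- z) x+z<y+z ⟩
    y + z + (- z)   ≈⟨ cancel y ⟩
    y               ∎
    where
    cancel : ∀ x → x + z + (- z) ≈ x
    cancel x = trans (+-assoc x z (- z)) (trans (+-congˡ (-‿inverseʳ z)) (+-identityʳ x))

  +-monoˡ-≤ : ∀ z → x ≤ y → x + z ≤ y + z
  +-monoˡ-≤ z x≤y y+z<x+z = x≤y (+-cancelʳ-< z y+z<x+z)

  +-monoʳ-≤ : ∀ z → x ≤ y → z + x ≤ z + y
  +-monoʳ-≤ {x} {y} z x≤y = begin
    z + x   ≈⟨ +-comm z x ⟩
    x + z   ≤⟨ +-monoˡ-≤ z x≤y ⟩
    y + z   ≈⟨ +-comm y z ⟩
    z + y   ∎

  +-mono-≤ : x ≤ y → x′ ≤ y′ → x + x′ ≤ y + y′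
  +-mono-≤ {y = y} {x′ = x′} x≤y x′≤y′ = ≤-trans (+-monoˡ-≤ x′ x≤y) (+-monoʳ-≤ y x′≤y′)

  +-mono-< : x < y → x′ < y′ → x + x′ < y + y′
  +-mono-< {x} {y} {x′} {y′} x<y x′<y′ = begin-strict
    x + x′   <⟨ +-monoˡ-< x′ x<y ⟩
    y + x′   ≈⟨ +-comm y x′ ⟩
    x′ + y   <⟨ +-monoˡ-< y x′<y′ ⟩
    y′ + y   ≈⟨ +-comm y′ y ⟩
    y + y′   ∎

  x≤x+y : 0# ≤ y → x ≤ x + y
  x≤x+y {y} {x} 0≤y = begin
    x        ≈⟨ +-identityʳ x ⟨
    x + 0#   ≤⟨ +-monoʳ-≤ x 0≤y ⟩
    x + y    ∎

  +-nonneg : 0# ≤ x → 0# ≤ y → 0# ≤ x + y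
  +-nonneg 0≤x 0≤y = ≤-trans 0≤x (x≤x+y 0≤y)

  *-monoˡ-< : 0# < z → x < y → z * x < z * y
  *-monoˡ-< {z} {x} {y} 0<z x<y = begin-strict
    z * x                            ≈⟨ +-identityˡ (z * x) ⟨
    0# + z * x                       <⟨ +-monoˡ-< (z * x) (*-pos 0<z 0<y-x) ⟩
    z * (y + (- x)) + z * x          ≈⟨ distribˡ z (y + (- x)) x ⟨
    z * (y + (- x) + x)              ≈⟨ *-congˡ (trans (+-assoc y (- x) x) (trans (+-congˡ (-‿inverseˡ x)) (+-identityʳ y))) ⟩
    z * y                            ∎
    where
    0<y-x : 0# < y + (- x)
    0<y-x = begin-strict
      0#         ≈⟨ -‿inverseʳ x ⟨
      x + (- x)  <⟨ +-monoˡ-< (- x) x<y ⟩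
      y + (- x)  ∎

  -- No sign can be decided here. A failure z y < z x excludes 0 < z, since x and y would then be
  -- equal, so it forces z = 0, where both products vanish.
  *-monoˡ-≤ : 0# ≤ z → x ≤ y → z * x ≤ z * y
  *-monoˡ-≤ {z} {x} {y} 0≤z x≤y zy<zx = <-irrefl (*-congʳ z≈0) 0y<0x
    where
    ¬0<z : z ≤ 0#
    ¬0<z 0<z = <-irrefl (*-congˡ (≤-antisym (λ x<y → <-asym zy<zx (*-monoˡ-< 0<z x<y)) x≤y)) zy<zx
    z≈0 : z ≈ 0#
    z≈0 = ≤-antisym ¬0<z 0≤z
    0y<0x : z * y < 0# * y
    0y<0x = begin-strict
      z * y    <⟨ zy<zx ⟩
      z * x    ≈⟨ *-congʳ z≈0 ⟩
      0# * x   ≈⟨ zeroˡ x ⟩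
      0#       ≈⟨ zeroˡ y ⟨
      0# * y   ∎

  *-monoʳ-≤ : 0# ≤ z → x ≤ y → x * z ≤ y * z
  *-monoʳ-≤ {z} {x} {y} 0≤z x≤y = begin
    x * z   ≈⟨ *-comm x z ⟩
    z * x   ≤⟨ *-monoˡ-≤ 0≤z x≤y ⟩
    z * y   ≈⟨ *-comm z y ⟩
    y * z   ∎

  *-cancelˡ-≤ : 0# < z → z * x ≤ z * y → x ≤ y
  *-cancelˡ-≤ 0<z zx≤zy y<x = zx≤zy (*-monoˡ-< 0<z y<x)

  *-nonneg : 0# ≤ x → 0# ≤ y → 0# ≤ x * y
  *-nonneg {x} {y} 0≤x 0≤y = begin
    0#       ≈⟨ zeroʳ x ⟨
    x * 0#   ≤⟨ *-monoˡ-≤ 0≤x 0≤y ⟩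
    x * y    ∎

  0<1 : 0# < 1#
  0<1 with #⇒<⊎> 1#0
  ... | inj₂ 0<1 = 0<1
  ... | inj₁ 1<0 = begin-strict
    0#              <⟨ *-pos 0<-1 0<-1 ⟩
    (- 1#) * (- 1#) ≈⟨ -‿distribˡ-* 1# (- 1#) ⟨
    - (1# * (- 1#)) ≈⟨ -‿cong (*-identityˡ (- 1#)) ⟩
    - (- 1#)        ≈⟨ -‿involutive 1# ⟩
    1#              ∎
    where
    0<-1 : 0# < - 1#
    0<-1 = begin-strict
      0#            ≈⟨ -‿inverseʳ 1# ⟨
      1# + (- 1#)   <⟨ +-monoˡ-< (- 1#) 1<0 ⟩
      0# + (- 1#)   ≈⟨ +-identityˡ (- 1#) ⟩
      - 1#          ∎

  -- Finite sums, sums over subsets and maximisation.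

  sum-mono : {f g : Fin n → Carrier} → (∀ i → f i ≤ g i) → sum f ≤ sum g
  sum-mono {n = ℕ.zero}  f≤g = ≤-refl
  sum-mono {n = ℕ.suc n} f≤g = +-mono-≤ (f≤g zero) (sum-mono (f≤g ∘ suc))

  sum-nonneg : {f : Fin n → Carrier} → (∀ i → 0# ≤ f i) → 0# ≤ sum f
  sum-nonneg {n = ℕ.zero}  0≤f = ≤-refl
  sum-nonneg {n = ℕ.suc n} 0≤f = +-nonneg (0≤f zero) (sum-nonneg (0≤f ∘ suc))

  term≤sum : {f : Fin n → Carrier} → (∀ i → 0# ≤ f i) → ∀ i → f i ≤ sum f
  term≤sum {f = f} 0≤f zero = x≤x+y (sum-nonneg (0≤f ∘ suc))
  term≤sum {f = f} 0≤f (suc i) = begin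
    f (suc i)                ≤⟨ term≤sum (0≤f ∘ suc) i ⟩
    sum (f ∘ suc)            ≤⟨ x≤x+y (0≤f zero) ⟩
    sum (f ∘ suc) + f zero   ≈⟨ +-comm _ _ ⟩
    sum f                    ∎

  indicator-nonneg : ∀ b → 0# ≤ x → 0# ≤ (if b then x else 0#)
  indicator-nonneg true  0≤x = 0≤x
  indicator-nonneg false 0≤x = ≤-refl

  sum-zero : (b : Fin n → Bool) (c : Fin n → Carrier) → (∀ i → b i ≢ true) →
    sum (λ i → if b i then c i else 0#) ≈ 0#
  sum-zero {n = n} b c b≢true = trans (sum-cong-≋ vanish) (sum-replicate-zero n)
    where
    vanish : ∀ i → (if b i then c i else 0#) ≈ 0#
    vanish i with b i in eq
    ... | true  = contradiction eq (b≢true i)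
    ... | false = refl

  sum-atMostOne : (b : Fin n → Bool) → 0# ≤ x → (∀ {i j} → b i ≡ true → b j ≡ true → i ≡ j) →
    sum (λ i → if b i then x else 0#) ≤ x
  sum-atMostOne {n = ℕ.zero}  b 0≤x unique = 0≤x
  sum-atMostOne {n = ℕ.suc n} {x = x} b 0≤x unique with b zero in eq
  ... | false = begin
    0# + sum rest   ≈⟨ +-identityˡ (sum rest) ⟩
    sum rest        ≤⟨ sum-atMostOne (b ∘ suc) 0≤x (λ p q → suc-injective (unique p q)) ⟩
    x               ∎
    where
    rest : Fin n → Carrier
    rest i = if b (suc i) then x else 0#
  ... | true = begin
    x + sum rest   ≈⟨ +-congˡ (sum-zero (b ∘ suc) (λ _ → x) (λ i p → contradiction (unique eq p) λ ())) ⟩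
    x + 0#         ≈⟨ +-identityʳ x ⟩
    x              ∎
    where
    rest : Fin n → Carrier
    rest i = if b (suc i) then x else 0#

  -- For a = `weight` this is definitionally the weight `w` of an edge set; other functions a serve
  -- as charges.
  total : (Fin n → Carrier) → Subset n → Carrier
  total a S = sum (λ i → if lookup S i then a i else 0#)

  indicator-∈ : (a : Fin n → Carrier) {S : Subset n} {i : Fin n} → i ∈ S →
    a i ≤ (if lookup S i then a i else 0#)
  indicator-∈ a {S} {i} i∈S =
    ≤-reflexive (reflexive (≡.sym (≡.cong (if_then a i else 0#) ([]=⇒lookup i∈S))))

  private
    does⇒ : {P : Set} (P? : Dec P) → does P? ≡ true → P
    does⇒ (yes p) _ = p

  -- The index b is the endpoint through which a target edge is charged; each
  -- endpoint is charged at most once, whence the factor 2.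
  charging : (a : Fin m → Carrier) (S : Subset m) (ĉ : Fin n → Carrier) (S′ : Subset n)
    (T : Bool → Fin m → Fin n → Set) →
    (∀ j → 0# ≤ ĉ j) →
    (∀ {i} → i ∈ S → ¬ ¬ (∃[ b ] ∃[ j ] (T b i j × j ∈ S′ × a i ≤ ĉ j))) →
    (∀ b j {i i′} → T b i j → T b i′ j → i ≡ i′) →
    total a S ≤ total ĉ S′ + total ĉ S′
  charging a S ĉ S′ T 0≤ĉ hit unique sum<total = do
    T? ← ¬¬-∀Fin λ i → ¬¬-∀Fin λ j → λ k → do
      p ← ¬¬-excluded-middle {A = T true i j}
      q ← ¬¬-excluded-middle {A = T false i j}
      k λ { true → p ; false → q }
    hit? ← ¬¬-∀Fin λ i → λ k → do
      yes i∈S ← ¬¬-excluded-middle {A = i ∈ S}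
        where no i∉S → k λ i∈S → contradiction i∈S i∉S
      (b , j , τ , j∈S′ , a≤ĉ) ← hit i∈S
      k λ _ → b , j , τ , ≤-trans a≤ĉ (indicator-∈ ĉ j∈S′)
    bound T? hit? sum<total
    where
    c : Fin _ → Carrier
    c j = if lookup S′ j then ĉ j else 0#
    0≤c : ∀ j → 0# ≤ c j
    0≤c j = indicator-nonneg (lookup S′ j) (0≤ĉ j)
    bound : (∀ i j b → Dec (T b i j)) →
      (∀ i → i ∈ S → ∃[ b ] ∃[ j ] (T b i j × a i ≤ c j)) → total a S ≤ sum c + sum c
    bound T? hit? = begin
      total a S                                            ≤⟨ sum-mono pointwise ⟩
      sum (λ i → sum (t true i) + sum (t false i))         ≈⟨ ∑-distrib-+ (λ i → sum (t true i)) (λ i → sum (t false i)) ⟩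
      sum (λ i → sum (t true i)) + sum (λ i → sum (t false i))
                                                           ≤⟨ +-mono-≤ (column true) (column false) ⟩
      sum c + sum c                                        ∎
      where
      -- One matrix of charges per endpoint b: by `unique` column j has at most one entry c j, and
      -- for i in S the two rows at i together cover a i.
      t : Bool → Fin _ → Fin _ → Carrier
      t b i j = if does (T? i j b) then c j else 0#
      0≤t : ∀ b i j → 0# ≤ t b i j
      0≤t b i j = indicator-nonneg (does (T? i j b)) (0≤c j)
      entry : ∀ {b i j} → T b i j → c j ≤ t b i j
      entry {b} {i} {j} τ with T? i j b
      ... | yes _ = ≤-refl
      ... | no ¬τ = contradiction τ ¬τ
      column : ∀ b → sum (λ i → sum (t b i)) ≤ sum c
      column b = begin
        sum (λ i → sum (t b i))            ≈⟨ ∑-comm (t b) ⟩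
        sum (λ j → sum (λ i → t b i j))    ≤⟨ sum-mono (λ j → sum-atMostOne (λ i → does (T? i j b)) (0≤c j)
                                                λ {i} {i′} p q → unique b j (does⇒ (T? i j b) p) (does⇒ (T? i′ j b) q)) ⟩
        sum c                              ∎
      row : ∀ i → i ∈ S → a i ≤ sum (t true i) + sum (t false i)
      row i i∈S with hit? i i∈S
      ... | true , j , τ , a≤c = begin
        a i                                ≤⟨ a≤c ⟩
        c j                                ≤⟨ entry τ ⟩
        t true i j                         ≤⟨ term≤sum (0≤t true i) j ⟩
        sum (t true i)                     ≤⟨ x≤x+y (sum-nonneg (0≤t false i)) ⟩
        sum (t true i) + sum (t false i)   ∎
      ... | false , j , τ , a≤c = begin
        a i                                ≤⟨ a≤c ⟩
        c j                                ≤⟨ entry τ ⟩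
        t false i j                        ≤⟨ term≤sum (0≤t false i) j ⟩
        sum (t false i)                    ≤⟨ x≤x+y (sum-nonneg (0≤t true i)) ⟩
        sum (t false i) + sum (t true i)   ≈⟨ +-comm _ _ ⟩
        sum (t true i) + sum (t false i)   ∎
      pointwise : ∀ i → (if lookup S i then a i else 0#) ≤ sum (t true i) + sum (t false i)
      pointwise i with lookup S i in eq
      ... | true  = row i (lookup⇒[]= i S eq)
      ... | false = +-nonneg (sum-nonneg (0≤t true i)) (sum-nonneg (0≤t false i))

  -- Every index is counted at least as often on the right as on the left. With S = N, T = A, S′ =
  -- (N ─ X) ∪ A and T′ = X this is the weight balance of exchanging X for A in N.
  total-exchange : (a : Fin n → Carrier) → (∀ i → 0# ≤ a i) → (S T S′ T′ : Subset n) →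
    (∀ {i} → i ∈ S → i ∈ S′ ⊎ i ∈ T′) → (∀ {i} → i ∈ T → i ∈ S′) → (∀ {i} → i ∈ S → i ∈ T → i ∈ T′) →
    total a S + total a T ≤ total a S′ + total a T′
  total-exchange a 0≤a S T S′ T′ S⊆ T⊆ S∩T⊆ = begin
    total a S + total a T      ≈⟨ ∑-distrib-+ (χ S) (χ T) ⟨
    sum (λ i → χ S i + χ T i)  ≤⟨ sum-mono pointwise ⟩
    sum (λ i → χ S′ i + χ T′ i) ≈⟨ ∑-distrib-+ (χ S′) (χ T′) ⟩
    total a S′ + total a T′    ∎
    where
    χ : Subset _ → Fin _ → Carrier
    χ S i = if lookup S i then a i else 0#
    0≤χ : ∀ S i → 0# ≤ χ S i
    0≤χ S i = indicator-nonneg (lookup S i) (0≤a i)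
    χ-in : ∀ {S i} → i ∈ S → a i ≤ χ S i
    χ-in = indicator-∈ a
    pointwise : ∀ i → χ S i + χ T i ≤ χ S′ i + χ T′ i
    pointwise i with lookup S i in p | lookup T i in q
    ... | true | true = +-mono-≤ (χ-in (T⊆ (lookup⇒[]= i T q)))
                                 (χ-in (S∩T⊆ (lookup⇒[]= i S p) (lookup⇒[]= i T q)))
    ... | true | false with S⊆ (lookup⇒[]= i S p)
    ...   | inj₁ i∈S′ = +-mono-≤ (χ-in i∈S′) (0≤χ T′ i)
    ...   | inj₂ i∈T′ = begin
      a i + 0#          ≈⟨ +-comm _ _ ⟩
      0# + a i          ≤⟨ +-mono-≤ (0≤χ S′ i) (χ-in i∈T′) ⟩
      χ S′ i + χ T′ i   ∎
    pointwise i | false | true = begin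
      0# + a i          ≈⟨ +-comm _ _ ⟩
      a i + 0#          ≤⟨ +-mono-≤ (χ-in (T⊆ (lookup⇒[]= i T q))) (0≤χ T′ i) ⟩
      χ S′ i + χ T′ i   ∎
    pointwise i | false | false = +-mono-≤ (0≤χ S′ i) (0≤χ T′ i)

  total-nonneg : (a : Fin n → Carrier) → (∀ i → 0# ≤ a i) → (S : Subset n) → 0# ≤ total a S
  total-nonneg a 0≤a S = sum-nonneg λ i → indicator-nonneg (lookup S i) (0≤a i)

  total-subadditive : (a : Fin n → Carrier) → (∀ i → 0# ≤ a i) → (S S′ T′ : Subset n) →
    (∀ {i} → i ∈ S → i ∈ S′ ⊎ i ∈ T′) → total a S ≤ total a S′ + total a T′
  total-subadditive a 0≤a S S′ T′ S⊆ = ≤-trans (x≤x+y (total-nonneg a 0≤a ∅))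
    (total-exchange a 0≤a S ∅ S′ T′ S⊆ (⊥-elim ∘ ∉⊥) (λ _ → ⊥-elim ∘ ∉⊥))

  total-atMostOne : (a : Fin n → Carrier) (S : Subset n) → 0# ≤ x → (∀ {i} → i ∈ S → a i ≤ x) →
    (∀ {i j} → i ∈ S → j ∈ S → i ≡ j) → total a S ≤ x
  total-atMostOne {x = x} a S 0≤x a≤x unique = ≤-trans (sum-mono pointwise)
    (sum-atMostOne (lookup S) 0≤x λ p q → unique (lookup⇒[]= _ S p) (lookup⇒[]= _ S q))
    where
    pointwise : ∀ i → (if lookup S i then a i else 0#) ≤ (if lookup S i then x else 0#)
    pointwise i with lookup S i in eq
    ... | true  = a≤x (lookup⇒[]= i S eq)
    ... | false = ≤-refl

  total-scale : ∀ x (a : Fin n → Carrier) (S : Subset n) → total (λ i → x * a i) S ≈ x * total a S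
  total-scale {n = n} x a S = trans (sum-cong-≋ pointwise) (sym (*-distribˡ-sum x χ))
    where
    χ : Fin n → Carrier
    χ i = if lookup S i then a i else 0#
    pointwise : ∀ i → (if lookup S i then x * a i else 0#) ≈ x * χ i
    pointwise i with lookup S i
    ... | true  = refl
    ... | false = sym (zeroʳ x)

  total-sum : (a : Fin m → Fin n → Carrier) (S : Subset n) →
    sum (λ i → total (a i) S) ≈ total (λ j → sum (λ i → a i j)) S
  total-sum {m = m} {n = n} a S = trans (∑-comm (λ i j → if lookup S j then a i j else 0#)) (sum-cong-≋ pointwise)
    where
    pointwise : ∀ j → sum (λ i → if lookup S j then a i j else 0#) ≈ (if lookup S j then sum (λ i → a i j) else 0#)
    pointwise j with lookup S j
    ... | true  = refl
    ... | false = sum-replicate-zero m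

  total-mono : {a b : Fin n → Carrier} → (∀ i → a i ≤ b i) → (S : Subset n) → total a S ≤ total b S
  total-mono {a = a} {b} a≤b S = sum-mono pointwise
    where
    pointwise : ∀ i → (if lookup S i then a i else 0#) ≤ (if lookup S i then b i else 0#)
    pointwise i with lookup S i
    ... | true  = a≤b i
    ... | false = ≤-refl

  -- Induction on whether the first index is taken, comparing the best set of either kind; P may be
  -- empty on one half, so emptiness is carried along as an alternative.
  maximiser : (P : Subset n → Set) (f : Subset n → Carrier) →
    ¬ ¬ ((∀ S → ¬ P S) ⊎ (∃[ S ] (P S × (∀ T → P T → f T ≤ f S))))
  maximiser {n = ℕ.zero} P f k = do
    yes p ← ¬¬-excluded-middle {A = P []}
      where no ¬p → k (inj₁ λ { [] → ¬p })
    k (inj₂ ([] , p , λ { [] _ → ≤-refl }))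
  maximiser {n = ℕ.suc n} P f k = do
    inj₂ (S , pS , maxS) ← maximiser (P ∘ (inside ∷_)) (f ∘ (inside ∷_))
      where
      inj₁ none → do
        inj₂ (T , pT , maxT) ← maximiser (P ∘ (outside ∷_)) (f ∘ (outside ∷_))
          where inj₁ none′ → k (inj₁ λ { (inside ∷ S) → none S ; (outside ∷ S) → none′ S })
        k (inj₂ (outside ∷ T , pT , λ { (inside ∷ S) p → contradiction p (none S) ; (outside ∷ S) → maxT S }))
    inj₂ (T , pT , maxT) ← maximiser (P ∘ (outside ∷_)) (f ∘ (outside ∷_))
      where inj₁ none′ → k (inj₂ (inside ∷ S , pS , λ { (inside ∷ S) → maxS S ; (outside ∷ S) p → contradiction p (none′ S) }))
    yes S<T ← ¬¬-excluded-middle {A = f (inside ∷ S) < f (outside ∷ T)}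
      where no T≤S → k (inj₂ (inside ∷ S , pS ,
                         λ { (inside ∷ S) → maxS S ; (outside ∷ S) p → ≤-trans (maxT S p) T≤S }))
    k (inj₂ (outside ∷ T , pT ,
        λ { (inside ∷ S) p → ≤-trans (maxS S p) (<⇒≤ S<T) ; (outside ∷ S) → maxT S }))

-- The total charge to one optimal edge over all classes.

module Costs (ℝ : Reals) where
  open Reals ℝ hiding (zero)
  open OrderedField ℝ
  open ≤-Reasoning

  private variable
    x y ℓ r c : Carrier
    k : ℕ

  ≤-split : ∀ x y → ¬ ¬ (x < y ⊎ y ≤ x)
  ≤-split x y k = do
    yes x<y ← ¬¬-excluded-middle {A = x < y}
      where no y≤x → k (inj₂ y≤x)
    k (inj₁ x<y)

  *-mono-≤ : ∀ {x x′ y y′} → 0# ≤ x → 0# ≤ y′ → x ≤ x′ → y ≤ y′ → x * y ≤ x′ * y′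
  *-mono-≤ 0≤x 0≤y′ x≤x′ y≤y′ = ≤-trans (*-monoˡ-≤ 0≤x y≤y′) (*-monoʳ-≤ 0≤y′ x≤x′)

  ·1-nonneg : ∀ n → 0# ≤ n · 1#
  ·1-nonneg ℕ.zero    = ≤-refl
  ·1-nonneg (ℕ.suc n) = +-nonneg (<⇒≤ 0<1) (·1-nonneg n)

  1≤^ : 1# ≤ x → ∀ n → 1# ≤ x ^ n
  1≤^ 1≤x ℕ.zero = ≤-refl
  1≤^ {x} 1≤x (ℕ.suc n) = begin
    1#          ≤⟨ 1≤x ⟩
    x           ≈⟨ *-identityʳ x ⟨
    x * 1#      ≤⟨ *-monoˡ-≤ (≤-trans (<⇒≤ 0<1) 1≤x) (1≤^ 1≤x n) ⟩
    x * x ^ n   ∎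

  -- δ^(n+1) - δ = d (δ + δ^2 + ... + δ^n), and each of the n summands is at most δ^n.
  geometric : ∀ d δ → 0# ≤ d → δ ≈ 1# + d → ∀ n → δ * δ ^ n ≤ δ + n · 1# * (d * δ ^ n)
  geometric d δ 0≤d δ≈ ℕ.zero = begin
    δ * 1#                    ≈⟨ *-identityʳ δ ⟩
    δ                         ≈⟨ +-identityʳ δ ⟨
    δ + 0#                    ≈⟨ +-congˡ (zeroˡ _) ⟨
    δ + 0# * (d * 1#)         ∎
  geometric d δ 0≤d δ≈ (ℕ.suc n) = begin
    δ * (δ * q)                          ≤⟨ *-monoˡ-≤ 0≤δ (geometric d δ 0≤d δ≈ n) ⟩
    δ * (δ + N * (d * q))                ≈⟨ *-congʳ δ≈ ⟩
    (1# + d) * (δ + N * (d * q))         ≈⟨ solve 4 (λ d δ N q → (con 1 :+ d) :* (δ :+ N :* (d :* q))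
                                              := δ :+ (d :* δ :+ N :* (d :* ((con 1 :+ d) :* q)))) refl d δ N q ⟩
    δ + (d * δ + N * (d * ((1# + d) * q))) ≈⟨ +-congˡ (+-congˡ (*-congˡ (*-congˡ (*-congʳ δ≈)))) ⟨
    δ + (d * δ + N * (d * (δ * q)))      ≤⟨ +-monoʳ-≤ δ (+-monoˡ-≤ _ (*-monoˡ-≤ 0≤d δ≤δq)) ⟩
    δ + (d * (δ * q) + N * (d * (δ * q))) ≈⟨ solve 4 (λ d δ N q → δ :+ (d :* (δ :* q) :+ N :* (d :* (δ :* q)))
                                              := δ :+ (con 1 :+ N) :* (d :* (δ :* q))) refl d δ N q ⟩
    δ + (1# + N) * (d * (δ * q))         ∎
    where
    q = δ ^ n
    N = n · 1#
    1≤δ : 1# ≤ δ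
    1≤δ = ≤-trans (x≤x+y 0≤d) (≤-reflexive (sym δ≈))
    0≤δ = ≤-trans (<⇒≤ 0<1) 1≤δ
    δ≤δq : δ ≤ δ * q
    δ≤δq = begin
      δ        ≈⟨ *-identityʳ δ ⟨
      δ * 1#   ≤⟨ *-monoˡ-≤ 0≤δ (1≤^ 1≤δ n) ⟩
      δ * q    ∎

  -- κ = 2n satisfies κ ≥ δ / (δ - 1), the sum of the geometric series of 1/δ.
  series-bound : ∀ δ n → 1# < δ → 1# + 1# ≤ δ ^ n → δ + (n · 1# + n · 1#) ≤ (n · 1# + n · 1#) * δ
  series-bound δ n 1<δ 2≤q = begin
    δ + (N + N)            ≤⟨ +-monoˡ-≤ (N + N) (*-cancelˡ-≤ 0<q qδ≤) ⟩
    (N + N) * d + (N + N)  ≈⟨ solve 2 (λ N d → (N :+ N) :* d :+ (N :+ N) := (N :+ N) :* (con 1 :+ d)) refl N d ⟩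
    (N + N) * (1# + d)     ≈⟨ *-congˡ δ≈ ⟨
    (N + N) * δ            ∎
    where
    N = n · 1#
    q = δ ^ n
    d = δ + (- 1#)
    δ≈ : δ ≈ 1# + d
    δ≈ = sym (trans (+-comm 1# d) (trans (+-assoc δ (- 1#) 1#) (trans (+-congˡ (-‿inverseˡ 1#)) (+-identityʳ δ))))
    0≤d : 0# ≤ d
    0≤d = +-cancelʳ-≤ 1# (begin
      0# + 1#   ≈⟨ +-identityˡ 1# ⟩
      1#        ≤⟨ <⇒≤ 1<δ ⟩
      δ         ≈⟨ δ≈ ⟩
      1# + d    ≈⟨ +-comm 1# d ⟩
      d + 1#    ∎)
    0≤δ = <⇒≤ (<-trans 0<1 1<δ)
    0<q : 0# < q
    0<q = <-≤-trans 0<1 (1≤^ (<⇒≤ 1<δ) n)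
    -- Two copies of `geometric` leave a term 2 δ, which `2≤q` absorbs into one of the two copies of
    -- δ q.
    qδ≤ : q * δ ≤ q * ((N + N) * d)
    qδ≤ = +-cancelʳ-≤ (δ * q) (begin
      q * δ + δ * q                         ≈⟨ solve 2 (λ q δ → q :* δ :+ δ :* q := δ :* q :+ δ :* q) refl q δ ⟩
      δ * q + δ * q                         ≤⟨ +-mono-≤ g g ⟩
      (δ + N * (d * q)) + (δ + N * (d * q)) ≈⟨ solve 4 (λ q d N δ → (δ :+ N :* (d :* q)) :+ (δ :+ N :* (d :* q))
                                               := q :* ((N :+ N) :* d) :+ δ :* (con 1 :+ con 1)) refl q d N δ ⟩
      q * ((N + N) * d) + δ * (1# + 1#)     ≤⟨ +-monoʳ-≤ _ (*-monoˡ-≤ 0≤δ 2≤q) ⟩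
      q * ((N + N) * d) + δ * q             ∎)
      where g = geometric d δ 0≤d δ≈ n

  module _ {ε z : Carrier} (0<ε : 0# < ε) (0<z : 0# < z) (εz≈1 : ε * z ≈ 1#) where

    ε[xz]≈x : ∀ x → ε * (x * z) ≈ x
    ε[xz]≈x x = begin-equality
      ε * (x * z)   ≈⟨ solve 3 (λ ε z x → ε :* (x :* z) := (ε :* z) :* x) refl ε z x ⟩
      (ε * z) * x   ≈⟨ *-congʳ εz≈1 ⟩
      1# * x        ≈⟨ *-identityˡ x ⟩
      x             ∎

    -- With z = 1/ε, the amount c that the class [ℓ, r) charges to an optimal edge
    -- of weight y.
    data Cost (y ℓ r : Carrier) : Carrier → Set where
      null : r ≤ 0# → Cost y ℓ r 0#
      low  : 0# < r → r * z ≤ y → Cost y ℓ r (r * z)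
      mid  : y < r * z → ε * ℓ ≤ y + y → Cost y ℓ r (y + y)
      far  : y < r * z → y + y < ε * ℓ → Cost y ℓ r 0#

    -- The cases of `Cost` are told apart by undecided comparisons; hence it is a relation, and its
    -- value exists only classically.
    cost-exists : ∀ y ℓ r → ¬ ¬ (∃[ c ] Cost y ℓ r c)
    cost-exists y ℓ r k = do
      -- The partition may extend below 0; a class with r ≤ 0 has no edge in its window.
      inj₁ 0<r ← ≤-split 0# r
        where inj₂ r≤0 → k (_ , null r≤0)
      inj₁ y<rz ← ≤-split y (r * z)
        where inj₂ rz≤y → k (_ , low 0<r rz≤y)
      inj₁ 2y<εℓ ← ≤-split (y + y) (ε * ℓ)
        where inj₂ εℓ≤2y → k (_ , mid y<rz εℓ≤2y)
      k (_ , far y<rz 2y<εℓ)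

    cost-nonneg : 0# ≤ y → Cost y ℓ r c → 0# ≤ c
    cost-nonneg 0≤y (null _)    = ≤-refl
    cost-nonneg 0≤y (low 0<r _) = <⇒≤ (*-pos 0<r 0<z)
    cost-nonneg 0≤y (mid _ _)   = +-nonneg 0≤y 0≤y
    cost-nonneg 0≤y (far _ _)   = ≤-refl

    r≤0⇒rz≤0 : r ≤ 0# → r * z ≤ 0#
    r≤0⇒rz≤0 {r} r≤0 = begin
      r * z    ≤⟨ *-monoʳ-≤ (<⇒≤ 0<z) r≤0 ⟩
      0# * z   ≈⟨ zeroˡ z ⟩
      0#       ∎

    -- Here x is the weight of a window edge and y that of an optimal neighbour, x ≤ 2 y. A
    -- neighbour above the window pays its top r z, any other pays 2 y, and one with 2 y < ε ℓ is
    -- too light to occur.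
    cost-window : Cost y ℓ r c → 0# < x → ε * ℓ ≤ x → x < r * z → x ≤ y + y → x ≤ c
    cost-window (null r≤0)  0<x εℓ≤x x<rz x≤2y = contradiction (<-trans 0<x x<rz) (r≤0⇒rz≤0 r≤0)
    cost-window (low _ _)   0<x εℓ≤x x<rz x≤2y = <⇒≤ x<rz
    cost-window (mid _ _)   0<x εℓ≤x x<rz x≤2y = x≤2y
    cost-window (far _ 2y<εℓ) 0<x εℓ≤x x<rz x≤2y = contradiction 2y<εℓ (≤-trans εℓ≤x x≤2y)

    -- Pays for a dropped class edge, of weight below r, by an edge of weight y above the window:
    -- unless r ≤ 0, the cost there is r z, and ε z = 1.
    cost-heavy : Cost y ℓ r c → r * z ≤ y → r ≤ ε * c
    cost-heavy {r = r} (null r≤0) rz≤y = ≤-trans r≤0 (≤-reflexive (sym (zeroʳ ε)))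
    cost-heavy {r = r} (low _ _) rz≤y = ≤-reflexive (sym (ε[xz]≈x r))
    cost-heavy (mid y<rz _) rz≤y = contradiction y<rz rz≤y
    cost-heavy (far y<rz _) rz≤y = contradiction y<rz rz≤y

    -- Unlike coverage of [1, W], adjacency survives the removal of the first class, as the
    -- inductions on k require.
    Adjacent : (ℓ r : Fin k → Carrier) → Set
    Adjacent ℓ r = ∀ i j → toℕ j ≡ ℕ.suc (toℕ i) → ℓ j ≈ r i

    adjacent-tail : {ℓ r : Fin (ℕ.suc k) → Carrier} → Adjacent ℓ r → Adjacent (ℓ ∘ suc) (r ∘ suc)
    adjacent-tail adj i j eq = adj (suc i) (suc j) (≡.cong ℕ.suc eq)

    -- The premise `toℕ i ≡ 0` speaks of the first remaining class without presupposing that one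
    -- remains.
    adjacent-first : {ℓ r : Fin (ℕ.suc k) → Carrier} → Adjacent ℓ r →
      ∀ i → toℕ i ≡ 0 → r zero ≤ ℓ (suc i)
    adjacent-first adj i eq = ≤-reflexive (sym (adj zero (suc i) (≡.cong ℕ.suc eq)))

    module _ {δ : Carrier} (1<δ : 1# < δ) where

      private
        0<δ : 0# < δ
        0<δ = <-trans 0<1 1<δ

        ≤δ* : 0# ≤ x → x ≤ δ * x
        ≤δ* {x} 0≤x = begin
          x        ≈⟨ *-identityˡ x ⟨
          1# * x   ≤⟨ *-monoʳ-≤ 0≤x (<⇒≤ 1<δ) ⟩
          δ * x    ∎

      r-increasing : ∀ {ρ} (ℓ r : Fin k → Carrier) → Adjacent ℓ r → (∀ i → δ * ℓ i ≤ r i) →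
        0# < ρ → (∀ i → toℕ i ≡ 0 → ρ ≤ ℓ i) → ∀ i → ρ ≤ r i
      r-increasing {ℕ.suc k} {ρ} ℓ r adj wide 0<ρ first = λ where
          zero    → ρ≤r₀
          (suc i) → ≤-trans ρ≤r₀ (r-increasing (ℓ ∘ suc) (r ∘ suc) (adjacent-tail adj) (wide ∘ suc)
                      (<-≤-trans 0<ρ ρ≤r₀) (adjacent-first adj) i)
        where
        ρ≤ℓ₀ = first zero ≡.refl
        ρ≤r₀ : ρ ≤ r zero
        ρ≤r₀ = ≤-trans ρ≤ℓ₀ (≤-trans (≤δ* (≤-trans (<⇒≤ 0<ρ) ρ≤ℓ₀)) (wide zero))

      -- m is a budget. Each class raises ρ by a factor of at least δ, so a `mid` class may consume
      -- one unit, and with none left ε ℓ exceeds 2 y. As y < ρ z, no class is `low`.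
      mid-sum : ∀ m {y ρ} (ℓ r c : Fin k → Carrier) → Adjacent ℓ r → (∀ i → δ * ℓ i ≤ r i) →
        (∀ i → Cost y (ℓ i) (r i) (c i)) → 0# < y → y < ρ * z → 0# < ρ →
        y + y < δ ^ m * (ε * ρ) → (∀ i → toℕ i ≡ 0 → ρ ≤ ℓ i) → sum c ≤ m · 1# * (y + y)
      mid-sum {ℕ.zero} m ℓ r c adj wide cost 0<y y<ρz 0<ρ 2y< first = *-nonneg (·1-nonneg m) (<⇒≤ (+-mono-0< 0<y))
        where
        +-mono-0< : 0# < y → 0# < y + y
        +-mono-0< 0<y = <-≤-trans 0<y (x≤x+y (<⇒≤ 0<y))
      mid-sum {ℕ.suc k} m {y} {ρ} ℓ r c adj wide cost 0<y y<ρz 0<ρ 2y< first = head (cost zero)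
        where
        ρ≤ℓ₀ : ρ ≤ ℓ zero
        ρ≤ℓ₀ = first zero ≡.refl
        δρ≤r₀ : δ * ρ ≤ r zero
        δρ≤r₀ = ≤-trans (*-monoˡ-≤ (<⇒≤ 0<δ) ρ≤ℓ₀) (wide zero)
        ρ≤r₀ : ρ ≤ r zero
        ρ≤r₀ = ≤-trans (≤δ* (<⇒≤ 0<ρ)) δρ≤r₀
        y<r₀z : y < r zero * z
        y<r₀z = <-≤-trans y<ρz (*-monoʳ-≤ (<⇒≤ 0<z) ρ≤r₀)
        0≤δ^ : ∀ m → 0# ≤ δ ^ m
        0≤δ^ m = ≤-trans (<⇒≤ 0<1) (1≤^ (<⇒≤ 1<δ) m)
        tail : ∀ m → y + y < δ ^ m * (ε * r zero) → sum (c ∘ suc) ≤ m · 1# * (y + y)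
        tail m 2y<′ = mid-sum m (ℓ ∘ suc) (r ∘ suc) (c ∘ suc) (adjacent-tail adj) (wide ∘ suc) (cost ∘ suc)
          0<y y<r₀z (<-≤-trans 0<ρ ρ≤r₀) 2y<′ (adjacent-first adj)
        head : ∀ {c₀} → Cost y (ℓ zero) (r zero) c₀ → c₀ + sum (c ∘ suc) ≤ m · 1# * (y + y)
        head (null r₀≤0)   = contradiction (<-≤-trans 0<ρ ρ≤r₀) r₀≤0
        head (low _ r₀z≤y) = contradiction y<r₀z r₀z≤y
        head (far _ _)     = begin
          0# + sum (c ∘ suc)   ≈⟨ +-identityˡ _ ⟩
          sum (c ∘ suc)        ≤⟨ tail m (<-≤-trans 2y< (*-monoˡ-≤ (0≤δ^ m) (*-monoˡ-≤ (<⇒≤ 0<ε) ρ≤r₀))) ⟩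
          m · 1# * (y + y)     ∎
        head (mid _ εℓ≤2y) = go m 2y<
          where
          go : ∀ m → y + y < δ ^ m * (ε * ρ) → (y + y) + sum (c ∘ suc) ≤ m · 1# * (y + y)
          go ℕ.zero 2y< = contradiction (begin-strict
            y + y          <⟨ 2y< ⟩
            1# * (ε * ρ)   ≈⟨ *-identityˡ _ ⟩
            ε * ρ          ≤⟨ *-monoˡ-≤ (<⇒≤ 0<ε) ρ≤ℓ₀ ⟩
            ε * ℓ zero     ∎) εℓ≤2y
          go (ℕ.suc m) 2y< = begin
            (y + y) + sum (c ∘ suc)            ≤⟨ +-monoʳ-≤ (y + y) (tail m (<-≤-trans 2y< shift)) ⟩
            (y + y) + m · 1# * (y + y)         ≈⟨ +-congʳ (*-identityˡ (y + y)) ⟨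
            1# * (y + y) + m · 1# * (y + y)    ≈⟨ distribʳ (y + y) 1# (m · 1#) ⟨
            (1# + m · 1#) * (y + y)            ∎
            where
            shift : δ ^ ℕ.suc m * (ε * ρ) ≤ δ ^ m * (ε * r zero)
            shift = begin
              (δ * δ ^ m) * (ε * ρ)   ≈⟨ solve 4 (λ δ q ε ρ → (δ :* q) :* (ε :* ρ) := q :* (ε :* (δ :* ρ))) refl δ (δ ^ m) ε ρ ⟩
              δ ^ m * (ε * (δ * ρ))   ≤⟨ *-monoˡ-≤ (0≤δ^ m) (*-monoˡ-≤ (<⇒≤ 0<ε) δρ≤r₀) ⟩
              δ ^ m * (ε * r zero)    ∎

      -- κ bounds the geometric series of the low costs. From the first class with y < r z to the
      -- last with ε ℓ ≤ 2 y the endpoints grow by a factor of at most 2 z * z, hence the condition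
      -- on m.
      module _ {κ : Carrier} (0≤κ : 0# ≤ κ) (δ+κ≤κδ : δ + κ ≤ κ * δ)
               (m : ℕ) (2z²≤δ^m : z * z + z * z ≤ δ ^ m) where

        private
          -- The first class with y < r z may pay 2 y by itself; the budget m counts from its right
          -- end.
          T : Carrier → Carrier
          T y = (y + y) + m · 1# * (y + y)

        -- The low costs telescope: r + κ ρ ≤ κ r whenever δ ρ ≤ r.
        cost-sum-from : ∀ {y ρ} (ℓ r c : Fin k → Carrier) → Adjacent ℓ r → (∀ i → δ * ℓ i ≤ r i) →
          (∀ i → Cost y (ℓ i) (r i) (c i)) → 0# < y → 0# ≤ ρ → ρ * z ≤ y →
          (∀ i → toℕ i ≡ 0 → 0# < ρ → ρ ≤ ℓ i) → sum c + κ * (ρ * z) ≤ κ * y + T y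
        cost-sum-from {ℕ.zero} {y} {ρ} ℓ r c adj wide cost 0<y 0≤ρ ρz≤y first = begin
          0# + κ * (ρ * z)   ≈⟨ +-identityˡ _ ⟩
          κ * (ρ * z)        ≤⟨ *-monoˡ-≤ 0≤κ ρz≤y ⟩
          κ * y              ≤⟨ x≤x+y (+-nonneg 0≤2y (*-nonneg (·1-nonneg m) 0≤2y)) ⟩
          κ * y + T y        ∎
          where 0≤2y = +-nonneg (<⇒≤ 0<y) (<⇒≤ 0<y)
        cost-sum-from {ℕ.suc k} {y} {ρ} ℓ r c adj wide cost 0<y 0≤ρ ρz≤y first = head (cost zero)
          where
          δρ≤r₀ : 0# < ρ → δ * ρ ≤ r zero
          δρ≤r₀ 0<ρ = ≤-trans (*-monoˡ-≤ (<⇒≤ 0<δ) (first zero ≡.refl 0<ρ)) (wide zero)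
          0≤2y : 0# ≤ y + y
          0≤2y = +-nonneg (<⇒≤ 0<y) (<⇒≤ 0<y)
          tail : ∀ {ρ} → 0# ≤ ρ → ρ * z ≤ y → (∀ i → toℕ i ≡ 0 → 0# < ρ → ρ ≤ ℓ (suc i)) →
            sum (c ∘ suc) + κ * (ρ * z) ≤ κ * y + T y
          tail = cost-sum-from (ℓ ∘ suc) (r ∘ suc) (c ∘ suc) (adjacent-tail adj) (wide ∘ suc) (cost ∘ suc) 0<y
          -- From the first class with y < r z on, `mid-sum` takes over; its premise holds as 2 y <
          -- 2 r z = (2 z z) (ε r).
          late : ∀ {c₀} → c₀ ≤ y + y → y < r zero * z → c₀ + sum (c ∘ suc) + κ * (ρ * z) ≤ κ * y + T y
          late {c₀} c₀≤2y y<r₀z = begin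
            c₀ + sum (c ∘ suc) + κ * (ρ * z)
              ≤⟨ +-mono-≤ (+-mono-≤ c₀≤2y (mid-sum m (ℓ ∘ suc) (r ∘ suc) (c ∘ suc) (adjacent-tail adj)
                   (wide ∘ suc) (cost ∘ suc) 0<y y<r₀z 0<r₀ 2y< (adjacent-first adj))) (*-monoˡ-≤ 0≤κ ρz≤y) ⟩
            T y + κ * y   ≈⟨ +-comm _ _ ⟩
            κ * y + T y   ∎
            where
            0<r₀ : 0# < r zero
            0<r₀ = begin-strict
              0#                 <⟨ *-pos 0<ε (<-trans 0<y y<r₀z) ⟩
              ε * (r zero * z)   ≈⟨ ε[xz]≈x (r zero) ⟩
              r zero             ∎
            2y< : y + y < δ ^ m * (ε * r zero)
            2y< = begin-strict
              y + y                                 <⟨ +-mono-< y<r₀z y<r₀z ⟩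
              r zero * z + r zero * z               ≈⟨ *-identityˡ _ ⟨
              1# * (r zero * z + r zero * z)        ≈⟨ *-congʳ εz≈1 ⟨
              (ε * z) * (r zero * z + r zero * z)   ≈⟨ solve 3 (λ ε z r → (ε :* z) :* (r :* z :+ r :* z)
                                                       := (z :* z :+ z :* z) :* (ε :* r)) refl ε z (r zero) ⟩
              (z * z + z * z) * (ε * r zero)        ≤⟨ *-monoʳ-≤ (<⇒≤ (*-pos 0<ε 0<r₀)) 2z²≤δ^m ⟩
              δ ^ m * (ε * r zero)                  ∎
          head : ∀ {c₀} → Cost y (ℓ zero) (r zero) c₀ → c₀ + sum (c ∘ suc) + κ * (ρ * z) ≤ κ * y + T y
          head (mid y<r₀z _) = late ≤-refl y<r₀z
          head (far y<r₀z _) = late 0≤2y y<r₀z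
          head (null r₀≤0) = begin
            0# + sum (c ∘ suc) + κ * (ρ * z)   ≈⟨ +-congʳ (+-identityˡ _) ⟩
            sum (c ∘ suc) + κ * (ρ * z)        ≤⟨ tail 0≤ρ ρz≤y (λ _ _ 0<ρ →
                                                    contradiction (<-≤-trans (*-pos 0<δ 0<ρ) (δρ≤r₀ 0<ρ)) r₀≤0) ⟩
            κ * y + T y                        ∎
          head (low 0<r₀ r₀z≤y) = begin
            r zero * z + sum (c ∘ suc) + κ * (ρ * z)
              ≈⟨ solve 5 (λ r z s κ ρ → r :* z :+ s :+ κ :* (ρ :* z) := s :+ (r :+ κ :* ρ) :* z) refl
                   (r zero) z (sum (c ∘ suc)) κ ρ ⟩
            sum (c ∘ suc) + (r zero + κ * ρ) * z
              ≤⟨ +-monoʳ-≤ _ (*-monoʳ-≤ (<⇒≤ 0<z) (*-cancelˡ-≤ 0<δ telescope)) ⟩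
            sum (c ∘ suc) + (κ * r zero) * z
              ≈⟨ +-congˡ (*-assoc κ (r zero) z) ⟩
            sum (c ∘ suc) + κ * (r zero * z)
              ≤⟨ tail (<⇒≤ 0<r₀) r₀z≤y (λ i eq _ → adjacent-first adj i eq) ⟩
            κ * y + T y ∎
            where
            δρ≤ : δ * ρ ≤ r zero
            δρ≤ r<δρ = do
              inj₁ 0<ρ ← ≤-split 0# ρ
                where inj₂ ρ≤0 → <-irrefl refl (begin-strict
                        0#       <⟨ 0<r₀ ⟩
                        r zero   <⟨ r<δρ ⟩
                        δ * ρ    ≤⟨ *-monoˡ-≤ (<⇒≤ 0<δ) ρ≤0 ⟩
                        δ * 0#   ≈⟨ zeroʳ δ ⟩
                        0#       ∎)
              δρ≤r₀ 0<ρ r<δρ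
            telescope : δ * (r zero + κ * ρ) ≤ δ * (κ * r zero)
            telescope = begin
              δ * (r zero + κ * ρ)         ≈⟨ solve 4 (λ δ r κ ρ → δ :* (r :+ κ :* ρ) := δ :* r :+ κ :* (δ :* ρ)) refl δ (r zero) κ ρ ⟩
              δ * r zero + κ * (δ * ρ)     ≤⟨ +-monoʳ-≤ _ (*-monoˡ-≤ 0≤κ δρ≤) ⟩
              δ * r zero + κ * r zero      ≈⟨ distribʳ (r zero) δ κ ⟨
              (δ + κ) * r zero             ≤⟨ *-monoʳ-≤ (<⇒≤ 0<r₀) δ+κ≤κδ ⟩
              (κ * δ) * r zero             ≈⟨ solve 3 (λ κ δ r → (κ :* δ) :* r := δ :* (κ :* r)) refl κ δ (r zero) ⟩
              δ * (κ * r zero)             ∎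

        -- The induction starts from ρ = 0; the first left end may be negative, which is why ρ ≤ ℓ
        -- is asked only for 0 < ρ.
        cost-sum : ∀ {y} (ℓ r c : Fin k → Carrier) → Adjacent ℓ r → (∀ i → δ * ℓ i ≤ r i) →
          (∀ i → Cost y (ℓ i) (r i) (c i)) → 0# < y → sum c ≤ κ * y + ((y + y) + m · 1# * (y + y))
        cost-sum {y = y} ℓ r c adj wide cost 0<y = begin
          sum c                    ≈⟨ solve 3 (λ s κ z → s :+ κ :* (con 0 :* z) := s) refl (sum c) κ z ⟨
          sum c + κ * (0# * z)     ≤⟨ cost-sum-from ℓ r c adj wide cost 0<y ≤-refl
                                        (≤-trans (≤-reflexive (zeroˡ z)) (<⇒≤ 0<y))
                                        (λ _ _ 0<0 → contradiction 0<0 ≤-refl) ⟩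
          κ * y + T y              ∎

-- Matchings, exchanges and alternating paths.

module Matchings (ℝ : Reals) {W} (G : WeightedMatching.WeightedGraph ℝ W) where
  open Reals ℝ hiding (zero)
  open OrderedField ℝ
  open WeightedMatching ℝ using (module WeightedGraph)
  open WeightedGraph G
  open ≤-Reasoning

  private variable
    e f : Edge
    s v x y y′ : Vertex
    S : EdgeSet

  0<weight : ∀ e → 0# < weight e
  0<weight e = <-≤-trans 0<1 (1≤weight e)

  0≤weight : ∀ e → 0# ≤ weight e
  0≤weight e = <⇒≤ (0<weight e)

  Joins : Edge → Vertex → Vertex → Set
  Joins e x y = (x ≡ proj₁ (ends e) × y ≡ proj₂ (ends e)) ⊎ (x ≡ proj₂ (ends e) × y ≡ proj₁ (ends e))

  joins-sym : Joins e x y → Joins e y x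
  joins-sym (inj₁ (p , q)) = inj₂ (q , p)
  joins-sym (inj₂ (p , q)) = inj₁ (q , p)

  joins-endpoint : Joins e x y → x EndpointOf e
  joins-endpoint (inj₁ (p , _)) = inj₁ p
  joins-endpoint (inj₂ (p , _)) = inj₂ p

  endpoint-joins : x EndpointOf e → ∃[ y ] Joins e x y
  endpoint-joins (inj₁ p) = _ , inj₁ (p , ≡.refl)
  endpoint-joins (inj₂ p) = _ , inj₂ (p , ≡.refl)

  -- The mixed cases would make e a loop, against `ordered`.
  joins-unique : Joins e x y → Joins e x y′ → y ≡ y′
  joins-unique (inj₁ (_ , q)) (inj₁ (_ , q′)) = ≡.trans q (≡.sym q′)
  joins-unique (inj₂ (_ , q)) (inj₂ (_ , q′)) = ≡.trans q (≡.sym q′)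
  joins-unique {e} (inj₁ (p , _)) (inj₂ (p′ , _)) =
    contradiction (≡.cong toℕ (≡.trans (≡.sym p) p′)) (<⇒≢ (ordered e))
  joins-unique {e} (inj₂ (p , _)) (inj₁ (p′ , _)) =
    contradiction (≡.cong toℕ (≡.trans (≡.sym p′) p)) (<⇒≢ (ordered e))

  joins-endpoints : Joins e x y → v EndpointOf e → v ≡ x ⊎ v ≡ y
  joins-endpoints (inj₁ (p , q)) (inj₁ r) = inj₁ (≡.trans r (≡.sym p))
  joins-endpoints (inj₁ (p , q)) (inj₂ r) = inj₂ (≡.trans r (≡.sym q))
  joins-endpoints (inj₂ (p , q)) (inj₁ r) = inj₂ (≡.trans r (≡.sym q))
  joins-endpoints (inj₂ (p , q)) (inj₂ r) = inj₁ (≡.trans r (≡.sym p))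

  Link : EdgeSet → Vertex → Vertex → Set
  Link S x y = ∃[ e ] (e ∈ S × Joins e x y)

  link-sym : Link S x y → Link S y x
  link-sym (e , e∈S , j) = e , e∈S , joins-sym j

  link-unique : IsMatching S → Link S x y → Link S x y′ → y ≡ y′
  link-unique matching (e , e∈S , j) (f , f∈S , j′)
    with ≡.refl ← matching e f _ e∈S f∈S (joins-endpoint j) (joins-endpoint j′) = joins-unique j j′

  matching-⊆ : ∀ {N} → IsMatching N → (∀ {e} → e ∈ S → e ∈ N) → IsMatching S
  matching-⊆ matching S⊆N e f v e∈S f∈S = matching e f v (S⊆N e∈S) (S⊆N f∈S)

  -- Names endpoints by Booleans, the form in which `charging` admits two charges per edge.
  side : Bool → Edge → Vertex
  side true  e = proj₁ (ends e)
  side false e = proj₂ (ends e)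

  endpoint-side : v EndpointOf e → ∃[ b ] v ≡ side b e
  endpoint-side (inj₁ p) = true , p
  endpoint-side (inj₂ p) = false , p

  side-endpoint : ∀ b e → side b e EndpointOf e
  side-endpoint true  e = inj₁ ≡.refl
  side-endpoint false e = inj₂ ≡.refl

  module Exchange {N A X : EdgeSet} (N-matching : IsMatching N) (A-matching : IsMatching A)
    (conflicts : ∀ {e f v} → e ∈ N → f ∈ A → v EndpointOf e → v EndpointOf f → e ∈ X) where

    result : EdgeSet
    result = (N ─ X) ∪ A

    result⁻ : e ∈ result → (e ∈ N × e ∉ X) ⊎ e ∈ A
    result⁻ e∈ with x∈p∪q⁻ (N ─ X) A e∈
    ... | inj₁ e∈N─X = inj₁ (p─q⊆p N X e∈N─X , λ e∈X → x∈p∩q⇒⊥ e∈N─X e∈X)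
      where
      x∈p∩q⇒⊥ : ∀ {n} {p q : Subset n} {i} → i ∈ p ─ q → i ∉ q
      x∈p∩q⇒⊥ {p = _ ∷ _} {q = outside ∷ _} (there i∈) (there i∈q) = x∈p∩q⇒⊥ i∈ i∈q
      x∈p∩q⇒⊥ {p = _ ∷ _} {q = inside ∷ _} (there i∈) (there i∈q) = x∈p∩q⇒⊥ i∈ i∈q
    ... | inj₂ e∈A = inj₂ e∈A

    matching : IsMatching result
    matching e f v e∈ f∈ ve vf with result⁻ e∈ | result⁻ f∈
    ... | inj₁ (e∈N , _)    | inj₁ (f∈N , _) = N-matching e f v e∈N f∈N ve vf
    ... | inj₁ (e∈N , e∉X)  | inj₂ f∈A = contradiction (conflicts e∈N f∈A ve vf) e∉X
    ... | inj₂ e∈A          | inj₁ (f∈N , f∉X) = contradiction (conflicts f∈N e∈A vf ve) f∉X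
    ... | inj₂ e∈A          | inj₂ f∈A = A-matching e f v e∈A f∈A ve vf

    weight-bound : w N + w A ≤ w result + w X
    weight-bound = total-exchange weight 0≤weight N A result X
      kept (λ e∈A → x∈p∪q⁺ (inj₂ e∈A))
      -- An edge common to N and A conflicts with itself, so it lies in X.
      (λ e∈N e∈A → conflicts e∈N e∈A (inj₁ ≡.refl) (inj₁ ≡.refl))
      where
      kept : e ∈ N → e ∈ result ⊎ e ∈ X
      kept {e} e∈N with e ∈? X
      ... | yes e∈X = inj₂ e∈X
      ... | no  e∉X = inj₁ (x∈p∪q⁺ (inj₁ (x∈p∧x∉q⇒x∈p─q e∈N e∉X)))

  -- M is the approximate matching on the current window and N the matching to be
  -- modified: C consists of its edges in the current class, K of its other edges
  -- in the window, Lg and H of its lighter and heavier edges.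
  module Augmentation {N M C K Lg H : EdgeSet}
    (N-matching : IsMatching N) (M-matching : IsMatching M)
    (C⊆N : ∀ {e} → e ∈ C → e ∈ N) (K⊆N : ∀ {e} → e ∈ K → e ∈ N)
    (Lg⊆N : ∀ {e} → e ∈ Lg → e ∈ N) (H⊆N : ∀ {e} → e ∈ H → e ∈ N)
    (C∩K : ∀ {e} → e ∈ C → e ∉ K) (Lg∩K : ∀ {e} → e ∈ Lg → e ∉ K) (H∩K : ∀ {e} → e ∈ H → e ∉ K)
    (N⊆ : ∀ {e} → e ∈ N → e ∈ C ⊎ e ∈ K ⊎ e ∈ Lg ⊎ e ∈ H)
    where

    -- Alternating paths M, K, M, K, ... from s: a `Walk` stops before a link of M, a `Reach` after
    -- one. Simplicity of the path is not imposed, as links of a matching are partial functions and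
    -- force every step.
    data Walk (s : Vertex) : Vertex → Set where
      start : Walk s s
      extend : ∀ {x u u′} → Walk s x → Link M x u → Link K u u′ → Walk s u′

    Reach : Vertex → Vertex → Set
    Reach s u = ∃[ x ] (Walk s x × Link M x u)

    K-matching : IsMatching K
    K-matching = matching-⊆ N-matching K⊆N

    private
      -- Walks grow at the far end, which suits tracing back to the source; trails
      -- grow at the near end, which suits uniqueness of the edge h where they stop.
      data Trail (h : Edge) (s : Vertex) : Set where
        stop : ∀ {u} → Link M s u → u EndpointOf h → Trail h s
        cons : ∀ {u u′} → Link M s u → Link K u u′ → Trail h u′ → Trail h s

      toTrail : ∀ {h s x} → Walk s x → Trail h x → Trail h s
      toTrail start               t = t
      toTrail (extend walk l l′) t = toTrail walk (cons l l′ t)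

      outside-K : ∀ {h u u′} → h ∈ N → h ∉ K → u EndpointOf h → ¬ Link K u u′
      outside-K {h} {u} h∈N h∉K uh (e , e∈K , j)
        with ≡.refl ← N-matching e h u (K⊆N e∈K) h∈N (joins-endpoint j) uh = h∉K e∈K

      -- Every step is forced, and at an endpoint of an edge of N outside K the path cannot
      -- continue, because N is a matching.
      trail-unique : ∀ {h h′ s} → h ∈ N → h ∉ K → h′ ∈ N → h′ ∉ K → Trail h s → Trail h′ s → h ≡ h′
      trail-unique {h} {h′} h∈ h∉K h′∈ h′∉K (stop l p) (stop l′ p′)
        with ≡.refl ← link-unique M-matching l l′ = N-matching h h′ _ h∈ h′∈ p p′
      trail-unique h∈ h∉K h′∈ h′∉K (stop l p) (cons l′ k _)
        with ≡.refl ← link-unique M-matching l l′ = contradiction k (outside-K h∈ h∉K p)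
      trail-unique h∈ h∉K h′∈ h′∉K (cons l k _) (stop l′ p′)
        with ≡.refl ← link-unique M-matching l l′ = contradiction k (outside-K h′∈ h′∉K p′)
      trail-unique h∈ h∉K h′∈ h′∉K (cons l k t) (cons l′ k′ t′)
        with ≡.refl ← link-unique M-matching l l′
        with ≡.refl ← link-unique K-matching k k′ = trail-unique h∈ h∉K h′∈ h′∉K t t′

    target-unique : ∀ {h h′ s u u′} → h ∈ N → h ∉ K → h′ ∈ N → h′ ∉ K →
      Reach s u → u EndpointOf h → Reach s u′ → u′ EndpointOf h′ → h ≡ h′
    target-unique h∈ h∉K h′∈ h′∉K (_ , walk , l) p (_ , walk′ , l′) p′ =
      trail-unique h∈ h∉K h′∈ h′∉K (toTrail walk (stop l p)) (toTrail walk′ (stop l′ p′))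

    AtCore : Vertex → Set
    AtCore s = ∃[ e ] (e ∈ C × s EndpointOf e)

    private
      core-no-link : AtCore s → ¬ Link K s x
      core-no-link (e , e∈C , se) = outside-K (C⊆N e∈C) (C∩K e∈C) se

      -- Both walks are traced back in step; neither ends before the other, since a core endpoint is
      -- covered by C and has no link of K.
      walk-source : ∀ {s s′ x} → AtCore s → AtCore s′ → Walk s x → Walk s′ x → s ≡ s′
      walk-source c c′ start start = ≡.refl
      walk-source c c′ start (extend _ _ k) = contradiction (link-sym k) (core-no-link c)
      walk-source c c′ (extend _ _ k) start = contradiction (link-sym k) (core-no-link c′)
      walk-source c c′ (extend walk l k) (extend walk′ l′ k′)
        with ≡.refl ← link-unique K-matching (link-sym k) (link-sym k′)
        with ≡.refl ← link-unique M-matching (link-sym l) (link-sym l′) = walk-source c c′ walk walk′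

    source-unique : ∀ {s s′ u} → AtCore s → AtCore s′ → Reach s u → Reach s′ u → s ≡ s′
    source-unique c c′ (_ , walk , l) (_ , walk′ , l′)
      with ≡.refl ← link-unique M-matching (link-sym l) (link-sym l′) = walk-source c c′ walk walk′

    Bad : Vertex → Set
    Bad s = ∃[ h ] ∃[ u ] (h ∈ H × u EndpointOf h × Reach s u)

    Good : Vertex → Set
    Good s = AtCore s × ¬ Bad s

    Active : Vertex → Set
    Active x = ∃[ s ] (Good s × Walk s x)

    Arrived : Vertex → Set
    Arrived u = ∃[ s ] (Good s × Reach s u)

    -- A and R are the parts of M and N to be swapped; D and L are the edges of C and Lg given up.
    -- An edge of C enters R only if neither endpoint is bad, as every edge of M meeting R must lie
    -- in A.
    InA InR InD InL : Edge → Set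
    InA f = f ∈ M × ∃[ x ] (Active x × x EndpointOf f)
    InR e = (e ∈ K × ∃[ u ] (Arrived u × u EndpointOf e)) ⊎ (e ∈ C × (∀ s → s EndpointOf e → ¬ Bad s))
    InD e = e ∈ C × ∃[ s ] (s EndpointOf e × Bad s)
    InL e = e ∈ Lg × ∃[ u ] (Arrived u × u EndpointOf e)

    -- Two exchanges at once: N takes A for R, D and L, while M takes R for A, so the weights of A
    -- and R cancel in `gain`. M′ consists of edges of M, K and C, so near-optimality of M can bound
    -- its weight.
    record Augmented : Set where
      field
        N′ M′ D L   : EdgeSet
        N′-matching : IsMatching N′
        N′⊆         : ∀ {e} → e ∈ N′ → (e ∈ N × e ∉ C) ⊎ e ∈ M
        M′-matching : IsMatching M′
        M′⊆         : ∀ {e} → e ∈ M′ → e ∈ M ⊎ e ∈ K ⊎ e ∈ C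
        D⊆          : ∀ {e} → e ∈ D → InD e
        L⊆          : ∀ {e} → e ∈ L → InL e
        gain        : w M + w N ≤ w M′ + (w N′ + (w D + w L))

    augmented : ¬ ¬ Augmented
    augmented k = do
      (A , A⁻ , A⁺) ← comprehension InA
      (R , R⁻ , R⁺) ← comprehension InR
      (D , D⁻ , D⁺) ← comprehension InD
      (L , L⁻ , L⁺) ← comprehension InL
      k (build A A⁻ A⁺ R R⁻ R⁺ D D⁻ D⁺ L L⁻ L⁺)
      where
      build : ∀ A → (∀ {e} → e ∈ A → InA e) → (∀ {e} → InA e → e ∈ A) →
              ∀ R → (∀ {e} → e ∈ R → InR e) → (∀ {e} → InR e → e ∈ R) →
              ∀ D → (∀ {e} → e ∈ D → InD e) → (∀ {e} → InD e → e ∈ D) →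
              ∀ L → (∀ {e} → e ∈ L → InL e) → (∀ {e} → InL e → e ∈ L) → Augmented
      build A A⁻ A⁺ R R⁻ R⁺ D D⁻ D⁺ L L⁻ L⁺ = record
        { N′ = NA.result ; M′ = MR.result ; D = D ; L = L
        ; N′-matching = NA.matching
        ; N′⊆ = λ e∈ → N′⊆ (NA.result⁻ e∈)
        ; M′-matching = MR.matching
        ; M′⊆ = λ e∈ → M′⊆ (MR.result⁻ e∈)
        ; D⊆ = D⁻ ; L⊆ = L⁻
        ; gain = gain
        }
        where
        X : EdgeSet
        X = R ∪ (D ∪ L)
        R⊆X : e ∈ R → e ∈ X
        R⊆X e∈R = x∈p∪q⁺ (inj₁ e∈R)
        D⊆X : e ∈ D → e ∈ X
        D⊆X e∈D = x∈p∪q⁺ {p = R} (inj₂ (x∈p∪q⁺ (inj₁ e∈D)))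
        L⊆X : e ∈ L → e ∈ X
        L⊆X e∈L = x∈p∪q⁺ {p = R} (inj₂ (x∈p∪q⁺ {p = D} (inj₂ e∈L)))

        ∈?-stable : ¬ ¬ (e ∈ X) → e ∈ X
        ∈?-stable {e} = decidable-stable (e ∈? X)

        -- Badness is undecided, but either answer puts e into X, and membership in X is stable.
        C⊆X : e ∈ C → e ∈ X
        C⊆X {e} e∈C = ∈?-stable λ e∉X → e∉X (R⊆X (R⁺ (inj₂ (e∈C ,
          λ s se bad → e∉X (D⊆X (D⁺ (e∈C , s , se , bad)))))))

        at-active : ∀ {x} → Active x → e ∈ N → x EndpointOf e → e ∈ X
        at-active {e} (s , ((f , f∈C , sf) , _) , start) e∈N se
          with ≡.refl ← N-matching e f s e∈N (C⊆N f∈C) se sf = C⊆X f∈C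
        at-active {e} (s , good , extend walk l (f , f∈K , j)) e∈N xe
          with ≡.refl ← N-matching e f _ e∈N (K⊆N f∈K) xe (joins-endpoint (joins-sym j)) =
          R⊆X (R⁺ (inj₁ (f∈K , _ , (s , good , _ , walk , l) , joins-endpoint j)))

        at-arrived : ∀ {u} → Arrived u → e ∈ N → u EndpointOf e → e ∈ X
        at-arrived arr@(s , (_ , ¬bad) , reach) e∈N ue with N⊆ e∈N
        ... | inj₁ e∈C = C⊆X e∈C
        ... | inj₂ (inj₁ e∈K) = R⊆X (R⁺ (inj₁ (e∈K , _ , arr , ue)))
        ... | inj₂ (inj₂ (inj₁ e∈L)) = L⊆X (L⁺ (e∈L , _ , arr , ue))
        -- A path from a good source never arrives at a heavier edge.
        ... | inj₂ (inj₂ (inj₂ e∈H)) = contradiction (_ , _ , e∈H , ue , reach) ¬bad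

        A-conflicts : ∀ {e f v} → e ∈ N → f ∈ A → v EndpointOf e → v EndpointOf f → e ∈ X
        A-conflicts e∈N f∈A ve vf with A⁻ f∈A
        ... | f∈M , x , act@(s , good , walk) , xf with endpoint-joins xf
        ... | u , j with joins-endpoints j vf
        ...   | inj₁ ≡.refl = at-active act e∈N ve
        ...   | inj₂ ≡.refl = at-arrived (s , good , x , walk , _ , f∈M , j) e∈N ve

        R-conflicts : ∀ {f e v} → f ∈ M → e ∈ R → v EndpointOf f → v EndpointOf e → f ∈ A
        R-conflicts {f} f∈M e∈R vf ve with R⁻ e∈R
        ... | inj₂ (e∈C , ¬bad) = A⁺ (f∈M , _ , (_ , ((_ , e∈C , ve) , ¬bad _ ve) , start) , vf)
        -- The path arrives at e in u: the edge of M at u is the one just walked, and at the other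
        -- end u′ the walk extends.
        ... | inj₁ (e∈K , u , (s , good , x , walk , l@(g , g∈M , j)) , ue) with endpoint-joins ue
        ...   | u′ , j′ with joins-endpoints j′ ve
        ...     | inj₂ ≡.refl = A⁺ (f∈M , _ , (s , good , extend walk l (_ , e∈K , j′)) , vf)
        ...     | inj₁ ≡.refl with ≡.refl ← M-matching f g u f∈M g∈M vf (joins-endpoint (joins-sym j)) =
                  A⁺ (f∈M , x , (s , good , walk) , joins-endpoint j)

        R⊆N : e ∈ R → e ∈ N
        R⊆N e∈R with R⁻ e∈R
        ... | inj₁ (e∈K , _) = K⊆N e∈K
        ... | inj₂ (e∈C , _) = C⊆N e∈C

        module NA = Exchange N-matching (matching-⊆ M-matching (proj₁ ∘ A⁻)) A-conflicts
        module MR = Exchange M-matching (matching-⊆ N-matching R⊆N) R-conflicts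

        N′⊆ : (e ∈ N × e ∉ X) ⊎ e ∈ A → (e ∈ N × e ∉ C) ⊎ e ∈ M
        N′⊆ (inj₁ (e∈N , e∉X)) = inj₁ (e∈N , λ e∈C → e∉X (C⊆X e∈C))
        N′⊆ (inj₂ e∈A) = inj₂ (proj₁ (A⁻ e∈A))

        M′⊆ : (e ∈ M × e ∉ A) ⊎ e ∈ R → e ∈ M ⊎ e ∈ K ⊎ e ∈ C
        M′⊆ (inj₁ (e∈M , _)) = inj₁ e∈M
        M′⊆ (inj₂ e∈R) with R⁻ e∈R
        ... | inj₁ (e∈K , _) = inj₂ (inj₁ e∈K)
        ... | inj₂ (e∈C , _) = inj₂ (inj₂ e∈C)

        wX≤ : w X ≤ w R + (w D + w L)
        wX≤ = begin
          w X                  ≤⟨ total-subadditive weight 0≤weight X R (D ∪ L) (x∈p∪q⁻ R (D ∪ L)) ⟩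
          w R + w (D ∪ L)      ≤⟨ +-monoʳ-≤ (w R) (total-subadditive weight 0≤weight (D ∪ L) D L (x∈p∪q⁻ D L)) ⟩
          w R + (w D + w L)    ∎

        gain : w M + w N ≤ w MR.result + (w NA.result + (w D + w L))
        gain = +-cancelʳ-≤ (w A + w R) (begin
          w M + w N + (w A + w R)
            ≈⟨ solve 4 (λ m n a r → (m :+ n) :+ (a :+ r) := (m :+ r) :+ (n :+ a)) refl (w M) (w N) (w A) (w R) ⟩
          (w M + w R) + (w N + w A)
            ≤⟨ +-mono-≤ MR.weight-bound (≤-trans NA.weight-bound (+-monoʳ-≤ (w NA.result) wX≤)) ⟩
          (w MR.result + w A) + (w NA.result + (w R + (w D + w L)))
            ≈⟨ solve 5 (λ m a n r x → (m :+ a) :+ (n :+ (r :+ x)) := (m :+ (n :+ x)) :+ (a :+ r)) refl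
                 (w MR.result) (w A) (w NA.result) (w R) (w D + w L) ⟩
          (w MR.result + (w NA.result + (w D + w L))) + (w A + w R)  ∎)

    -- Each lighter edge given up is charged to a class edge whose path arrives at it; by
    -- `target-unique` the path from one endpoint arrives at only one such edge.
    lighter-charge : (c : Edge → Carrier) → (∀ e → 0# ≤ c e) →
      (∀ {h e} → h ∈ Lg → e ∈ C → weight h ≤ c e) → (∀ {h} → h ∈ S → InL h) →
      w S ≤ total c C + total c C
    lighter-charge {S} c 0≤c cheap S⊆ = charging weight S c C T 0≤c hit unique
      where
      T : Bool → Edge → Edge → Set
      T b h e = h ∈ Lg × ∃[ u ] (Reach (side b e) u × u EndpointOf h)
      hit : ∀ {h} → h ∈ S → ¬ ¬ (∃[ b ] ∃[ e ] (T b h e × e ∈ C × weight h ≤ c e))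
      hit h∈S k with S⊆ h∈S
      ... | h∈L , u , (s , ((e , e∈C , se) , _) , reach) , uh with endpoint-side se
      ... | b , ≡.refl = k (b , e , (h∈L , u , reach , uh) , e∈C , cheap h∈L e∈C)
      unique : ∀ b e {h h′} → T b h e → T b h′ e → h ≡ h′
      unique b e (h∈L , u , reach , uh) (h′∈L , u′ , reach′ , u′h′) =
        target-unique (Lg⊆N h∈L) (Lg∩K h∈L) (Lg⊆N h′∈L) (Lg∩K h′∈L) reach uh reach′ u′h′

    -- Each dropped class edge is charged to a heavier edge that its path runs into; by
    -- `source-unique` an endpoint of that edge is reached from only one source. S′ will be the
    -- optimal matching.
    heavier-charge : (c : Edge → Carrier) → (∀ e → 0# ≤ c e) →
      (∀ {e h} → e ∈ C → h ∈ H → weight e ≤ c h) → (∀ {e} → e ∈ S → InD e) →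
      ∀ {S′} → (∀ {h} → h ∈ H → h ∈ S′) → w S ≤ total c S′ + total c S′
    heavier-charge {S} c 0≤c cheap S⊆ {S′} H⊆ = charging weight S c S′ T 0≤c hit unique
      where
      T : Bool → Edge → Edge → Set
      T b e h = e ∈ C × ∃[ s ] (s EndpointOf e × Reach s (side b h))
      hit : ∀ {e} → e ∈ S → ¬ ¬ (∃[ b ] ∃[ h ] (T b e h × h ∈ S′ × weight e ≤ c h))
      hit e∈S k with S⊆ e∈S
      ... | e∈C , s , se , (h , u , h∈H , uh , reach) with endpoint-side uh
      ... | b , ≡.refl = k (b , h , (e∈C , s , se , reach) , H⊆ h∈H , cheap e∈C h∈H)
      unique : ∀ b h {e e′} → T b e h → T b e′ h → e ≡ e′
      unique b h (e∈C , s , se , reach) (e′∈C , s′ , s′e′ , reach′)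
        with ≡.refl ← source-unique (_ , e∈C , se) (_ , e′∈C , s′e′) reach reach′ =
        N-matching _ _ s (C⊆N e∈C) (C⊆N e′∈C) se s′e′

  -- Local optimality of a maximum weight matching.

  module Optimal {M* : EdgeSet} (M*-matching : IsMatching M*)
    (M*-optimal : ∀ N → IsMatching N → w N ≤ w M*) where

    -- Otherwise the at most two edges of M* meeting f weigh less than half of f each, and
    -- exchanging them for f improves M*.
    heavy-neighbour : ∀ f → ¬ ¬ (∃[ b ] ∃[ e ] (e ∈ M* × side b e EndpointOf f × weight f ≤ weight e + weight e))
    heavy-neighbour f k = do
      (T₁ , T₁⁻ , T₁⁺) ← comprehension (λ e → e ∈ M* × side true f EndpointOf e)
      (T₂ , T₂⁻ , T₂⁺) ← comprehension (λ e → e ∈ M* × side false f EndpointOf e)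
      (x₁ , T₁≤x₁ , x₁<f) ← small true T₁ T₁⁻
      (x₂ , T₂≤x₂ , x₂<f) ← small false T₂ T₂⁻
      let module Ex = Exchange {X = T₁ ∪ T₂} M*-matching (singleton-matching f)
            (λ e∈M* g∈ ve vg → conflicts T₁⁺ T₂⁺ e∈M* (≡.subst (_ EndpointOf_) (x∈⁅y⁆⇒x≡y f g∈) vg) ve)
      -- The inequality `weight f ≤ x₁ + x₂` is doubled to meet 2 x < `weight f` without division.
      <-irrefl refl (begin-strict
        weight f + weight f    ≤⟨ +-mono-≤ (bound T₁ T₂ Ex.matching Ex.weight-bound T₁≤x₁ T₂≤x₂)
                                           (bound T₁ T₂ Ex.matching Ex.weight-bound T₁≤x₁ T₂≤x₂) ⟩
        (x₁ + x₂) + (x₁ + x₂)  ≈⟨ solve 2 (λ x y → (x :+ y) :+ (x :+ y) := (x :+ x) :+ (y :+ y)) refl x₁ x₂ ⟩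
        (x₁ + x₁) + (x₂ + x₂)  <⟨ +-mono-< x₁<f x₂<f ⟩
        weight f + weight f    ∎)
      where
      singleton-matching : ∀ f → IsMatching ⁅ f ⁆
      singleton-matching f e g v e∈ g∈ _ _ = ≡.trans (x∈⁅y⁆⇒x≡y f e∈) (≡.sym (x∈⁅y⁆⇒x≡y f g∈))

      -- Either the edge of M* at this endpoint is heavy enough and goes to `k`, or its weight is a
      -- valid x; an uncovered endpoint takes x = 0.
      small : ∀ b T → (∀ {e} → e ∈ T → e ∈ M* × side b f EndpointOf e) →
        ¬ ¬ (∃[ x ] (w T ≤ x × x + x < weight f))
      small b T T⁻ k′ = do
        yes (e , e∈T) ← ¬¬-excluded-middle {A = ∃[ e ] (e ∈ T)}
          where no none → k′ (0# , total-atMostOne weight T ≤-refl (λ e∈T → contradiction (_ , e∈T) none)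
                                     (λ e∈T _ → contradiction (_ , e∈T) none)
                                 , ≤-<-trans (≤-reflexive (+-identityˡ 0#)) (0<weight f))
        let unique = λ {e} {e′} (e∈T : e ∈ T) (e′∈T : e′ ∈ T) →
              M*-matching e e′ _ (proj₁ (T⁻ e∈T)) (proj₁ (T⁻ e′∈T)) (proj₂ (T⁻ e∈T)) (proj₂ (T⁻ e′∈T))
        yes lt ← ¬¬-excluded-middle {A = weight e + weight e < weight f}
          where no ge → let (c , p) = endpoint-side (proj₂ (T⁻ e∈T)) in
                  k (c , e , proj₁ (T⁻ e∈T) , ≡.subst (_EndpointOf f) p (side-endpoint b f) , ge)
        k′ (weight e , total-atMostOne weight T (0≤weight e)
              (λ e′∈T → ≤-reflexive (reflexive (≡.cong weight (unique e′∈T e∈T)))) unique , lt)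

      conflicts : ∀ {T₁ T₂} →
        (∀ {e} → e ∈ M* × side true f EndpointOf e → e ∈ T₁) →
        (∀ {e} → e ∈ M* × side false f EndpointOf e → e ∈ T₂) →
        ∀ {e v} → e ∈ M* → v EndpointOf f → v EndpointOf e → e ∈ T₁ ∪ T₂
      conflicts T₁⁺ T₂⁺ e∈M* (inj₁ ≡.refl) ve = x∈p∪q⁺ (inj₁ (T₁⁺ (e∈M* , ve)))
      conflicts {T₁} T₁⁺ T₂⁺ e∈M* (inj₂ ≡.refl) ve = x∈p∪q⁺ {p = T₁} (inj₂ (T₂⁺ (e∈M* , ve)))

      bound : ∀ T₁ T₂ {N x₁ x₂} → IsMatching N → w M* + w ⁅ f ⁆ ≤ w N + w (T₁ ∪ T₂) →
        w T₁ ≤ x₁ → w T₂ ≤ x₂ → weight f ≤ x₁ + x₂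
      bound T₁ T₂ {N} {x₁} {x₂} N-matching exchange T₁≤ T₂≤ = +-cancelʳ-≤ (w M*) (begin
        weight f + w M*      ≈⟨ +-comm _ _ ⟩
        w M* + weight f      ≤⟨ +-monoʳ-≤ (w M*) (≤-trans (indicator-∈ weight (x∈⁅x⁆ f))
                                  (term≤sum (λ e → indicator-nonneg (lookup ⁅ f ⁆ e) (0≤weight e)) f)) ⟩
        w M* + w ⁅ f ⁆       ≤⟨ exchange ⟩
        w N + w (T₁ ∪ T₂)    ≤⟨ +-mono-≤ (M*-optimal N N-matching)
                                  (total-subadditive weight 0≤weight (T₁ ∪ T₂) T₁ T₂ (x∈p∪q⁻ T₁ T₂)) ⟩
        w M* + (w T₁ + w T₂) ≤⟨ +-monoʳ-≤ (w M*) (+-mono-≤ T₁≤ T₂≤) ⟩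
        w M* + (x₁ + x₂)     ≈⟨ +-comm _ _ ⟩
        (x₁ + x₂) + w M*     ∎)

    -- Edges are charged to the neighbour from `heavy-neighbour`; as S is a matching, each endpoint
    -- of that neighbour is charged once.
    matching-charge : (c : Edge → Carrier) → (∀ e → 0# ≤ c e) → IsMatching S →
      (∀ {f e} → f ∈ S → weight f ≤ weight e + weight e → weight f ≤ c e) →
      w S ≤ total c M* + total c M*
    matching-charge {S} c 0≤c S-matching cheap = charging weight S c M* T 0≤c hit unique
      where
      T : Bool → Edge → Edge → Set
      T b f e = f ∈ S × side b e EndpointOf f
      hit : ∀ {f} → f ∈ S → ¬ ¬ (∃[ b ] ∃[ e ] (T b f e × e ∈ M* × weight f ≤ c e))
      hit {f} f∈S k = do
        (b , e , e∈M* , p , f≤2e) ← heavy-neighbour f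
        k (b , e , (f∈S , p) , e∈M* , cheap f∈S f≤2e)
      unique : ∀ b e {f f′} → T b f e → T b f′ e → f ≡ f′
      unique b e (f∈S , p) (f′∈S , p′) = S-matching _ _ _ f∈S f′∈S p p′

-- Treating the classes one after another.

module Composition (ℝ : Reals) {W} (G : WeightedMatching.WeightedGraph ℝ W) where
  open Reals ℝ hiding (zero)
  open OrderedField ℝ
  open Costs ℝ
  open WeightedMatching ℝ using (module WeightedGraph)
  open WeightedGraph G
  open Matchings ℝ G
  open ≤-Reasoning

  module _ {ε z : Carrier} (0<ε : 0# < ε) (0<z : 0# < z) (ε≤1 : ε ≤ 1#) (1≤z : 1# ≤ z) (εz≈1 : ε * z ≈ 1#)
    {M* : EdgeSet} (M*-matching : IsMatching M*) (M*-optimal : ∀ N → IsMatching N → w N ≤ w M*)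
    where

    private
      0≤ε = <⇒≤ 0<ε

    open Optimal M*-matching M*-optimal

    Window Class : Carrier → Carrier → Edge → Set
    Window ℓ r = Restrict (ε * ℓ) (r * z)
    Class ℓ r e = weight e ∈[ ℓ , r ⟩

    class⇒window : ∀ {ℓ r e} → Class ℓ r e → Window ℓ r e
    class⇒window {ℓ} {r} {e} (ℓ≤e , e<r) = (begin
      ε * ℓ           ≤⟨ *-monoˡ-≤ 0≤ε ℓ≤e ⟩
      ε * weight e    ≤⟨ *-monoʳ-≤ (0≤weight e) ε≤1 ⟩
      1# * weight e   ≈⟨ *-identityˡ _ ⟩
      weight e        ∎) , (begin-strict
      weight e        <⟨ e<r ⟩
      r               ≈⟨ *-identityʳ r ⟨
      r * 1#          ≤⟨ *-monoˡ-≤ (<⇒≤ (<-trans (0<weight e) e<r)) 1≤z ⟩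
      r * z           ∎)

    -- In units of ε S, one class loses 2 by the near-optimality of M, 2 by dropped class edges and
    -- 4 by lighter edges.
    loss : Carrier → Carrier
    loss S = 8 · 1# * (ε * S)

    μ-exists : ∀ H → ¬ ¬ (∃[ m ] Isμ H m)
    μ-exists H k = do
      inj₂ (X , X-in , X-max) ← maximiser (λ N → N MatchingIn H) w
        where inj₁ none → none ∅ ((λ e _ _ e∈∅ → ⊥-elim (∉⊥ e∈∅)) , λ e e∈∅ → ⊥-elim (∉⊥ e∈∅))
      k (w X , X-max , λ k′ → k′ (X , X-in , refl))

    -- `heavy-optimal` is the invariant of the treatment from light to heavy: edges of N above the
    -- window still belong to M*, so dropped class edges can be charged to them.
    module Step {N M : EdgeSet} {ℓ r : Carrier} {c : Edge → Carrier}
      (N-matching : IsMatching N) (M-approx : IsApproxMWM ε (Window ℓ r) M)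
      (cost : ∀ e → Cost 0<ε 0<z εz≈1 (weight e) ℓ r (c e))
      (heavy-optimal : ∀ {e} → e ∈ N → r * z ≤ weight e → e ∈ M*)
      where

      0≤c : ∀ e → 0# ≤ c e
      0≤c e = cost-nonneg 0<ε 0<z εz≈1 (0≤weight e) (cost e)

      in-window-bound : ∀ {X} → IsMatching X → (∀ {e} → e ∈ X → Window ℓ r e) →
        w X ≤ total c M* + total c M*
      in-window-bound X-matching X⊆ = matching-charge c 0≤c X-matching λ {f} {e} f∈X f≤2e →
        cost-window 0<ε 0<z εz≈1 (cost e) (0<weight f) (proj₁ (X⊆ f∈X)) (proj₂ (X⊆ f∈X)) f≤2e

      Result : Set
      Result = ∃[ N′ ] (IsMatching N′ × (∀ {e} → e ∈ N′ → (e ∈ N × ¬ Class ℓ r e) ⊎ e ∈ M) ×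
                        w N ≤ w N′ + loss (total c M*))

      approx-bound : ∀ {m} → Isμ (Window ℓ r) m → m ≤ w M + ε * m
      approx-bound {m} isμ = begin
        m                        ≈⟨ solve 1 (λ m → con 1 :* m := m) refl m ⟨
        1# * m                   ≈⟨ *-congʳ (trans (+-assoc 1# (- ε) ε) (trans (+-congˡ (-‿inverseˡ ε)) (+-identityʳ 1#))) ⟨
        (1# - ε + ε) * m         ≈⟨ distribʳ m (1# - ε) ε ⟩
        (1# - ε) * m + ε * m     ≤⟨ +-monoˡ-≤ (ε * m) (proj₂ M-approx m isμ) ⟩
        w M + ε * m              ∎

      step : ¬ ¬ Result
      step k = do
        (C , C⁻ , C⁺) ← comprehension (λ e → e ∈ N × Class ℓ r e)
        (K , K⁻ , K⁺) ← comprehension (λ e → e ∈ N × Window ℓ r e × ¬ Class ℓ r e)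
        (Lg , Lg⁻ , Lg⁺) ← comprehension (λ e → e ∈ N × weight e < ε * ℓ)
        (H , H⁻ , H⁺) ← comprehension (λ e → e ∈ N × r * z ≤ weight e)
        (m , isμ@(m-max , m-attained)) ← μ-exists (Window ℓ r)
        (X , (X-matching , X⊆) , wX≈m) ← m-attained
        let
          classify : ∀ {e} → e ∈ N → e ∈ C ⊎ e ∈ K ⊎ e ∈ Lg ⊎ e ∈ H
          classify {e} e∈N = decidable-stable
            (e ∈? C ⊎-dec e ∈? K ⊎-dec e ∈? Lg ⊎-dec e ∈? H) λ none → do
              inj₂ εℓ≤e ← ≤-split (weight e) (ε * ℓ)
                where inj₁ e<εℓ → none (inj₂ (inj₂ (inj₁ (Lg⁺ (e∈N , e<εℓ)))))
              inj₁ e<rz ← ≤-split (weight e) (r * z)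
                where inj₂ rz≤e → none (inj₂ (inj₂ (inj₂ (H⁺ (e∈N , rz≤e)))))
              none (inj₂ (inj₁ (K⁺ (e∈N , (εℓ≤e , e<rz) , λ cls → none (inj₁ (C⁺ (e∈N , cls)))))))
          module Aug = Augmentation {N} {M} {C} {K} {Lg} {H} N-matching (proj₁ (proj₁ M-approx))
            (proj₁ ∘ C⁻) (proj₁ ∘ K⁻) (proj₁ ∘ Lg⁻) (proj₁ ∘ H⁻)
            (λ e∈C e∈K → proj₂ (proj₂ (K⁻ e∈K)) (proj₂ (C⁻ e∈C)))
            (λ e∈L e∈K → proj₁ (proj₁ (proj₂ (K⁻ e∈K))) (proj₂ (Lg⁻ e∈L)))
            (λ e∈H e∈K → proj₂ (H⁻ e∈H) (proj₂ (proj₁ (proj₂ (K⁻ e∈K)))))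
            classify
        aug ← Aug.augmented
        let
          open Aug.Augmented aug
          S = total c M*
          C-window : ∀ {e} → e ∈ C → Window ℓ r e
          C-window e∈C = class⇒window (proj₂ (C⁻ e∈C))
          M′-window : ∀ {e} → e ∈ M ⊎ e ∈ K ⊎ e ∈ C → Window ℓ r e
          M′-window = λ where
            (inj₁ e∈M)        → proj₂ (proj₁ M-approx) _ e∈M
            (inj₂ (inj₁ e∈K)) → proj₁ (proj₂ (K⁻ e∈K))
            (inj₂ (inj₂ e∈C)) → C-window e∈C
          εm≤ : ε * m ≤ ε * (S + S)
          εm≤ = *-monoˡ-≤ 0≤ε (≤-trans (≤-reflexive (sym wX≈m)) (in-window-bound X-matching (X⊆ _)))
          εwC≤ : ε * w C ≤ ε * (S + S)
          εwC≤ = *-monoˡ-≤ 0≤ε (in-window-bound (matching-⊆ N-matching (proj₁ ∘ C⁻)) C-window)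
          wL≤ : w L ≤ ε * (S + S) + ε * (S + S)
          wL≤ = begin
            w L   ≤⟨ Aug.lighter-charge (λ e → ε * weight e) (λ e → *-nonneg 0≤ε (0≤weight e))
                      (λ {h} {e} h∈L e∈C → ≤-trans (<⇒≤ (proj₂ (Lg⁻ h∈L))) (*-monoˡ-≤ 0≤ε (proj₁ (proj₂ (C⁻ e∈C)))))
                      L⊆ ⟩
            total (λ e → ε * weight e) C + total (λ e → ε * weight e) C
                  ≈⟨ +-cong (total-scale ε weight C) (total-scale ε weight C) ⟩
            ε * w C + ε * w C
                  ≤⟨ +-mono-≤ εwC≤ εwC≤ ⟩
            ε * (S + S) + ε * (S + S)   ∎
          wD≤ : w D ≤ ε * S + ε * S
          wD≤ = begin
            w D   ≤⟨ Aug.heavier-charge (λ e → ε * c e) (λ e → *-nonneg 0≤ε (0≤c e))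
                      (λ {e} {h} e∈C h∈H → ≤-trans (<⇒≤ (proj₂ (proj₂ (C⁻ e∈C))))
                        (cost-heavy 0<ε 0<z εz≈1 (cost h) (proj₂ (H⁻ h∈H))))
                      D⊆ (λ h∈H → heavy-optimal (proj₁ (H⁻ h∈H)) (proj₂ (H⁻ h∈H))) ⟩
            total (λ e → ε * c e) M* + total (λ e → ε * c e) M*
                  ≈⟨ +-cong (total-scale ε c M*) (total-scale ε c M*) ⟩
            ε * S + ε * S ∎
          keep-or-new : ∀ {e} → (e ∈ N × e ∉ C) ⊎ e ∈ M → (e ∈ N × ¬ Class ℓ r e) ⊎ e ∈ M
          keep-or-new = λ where
            (inj₁ (e∈N , e∉C)) → inj₁ (e∈N , λ cls → e∉C (C⁺ (e∈N , cls)))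
            (inj₂ e∈M)         → inj₂ e∈M
          bound : w N ≤ w N′ + loss S
          -- M′ is a matching in the window, so it weighs at most m, which exceeds `w M` by at most
          -- ε m; then `w M` cancels.
          bound = +-cancelʳ-≤ (w M) (begin
            w N + w M
              ≈⟨ +-comm _ _ ⟩
            w M + w N
              ≤⟨ gain ⟩
            w M′ + (w N′ + (w D + w L))
              ≤⟨ +-mono-≤ (≤-trans (m-max M′ (M′-matching , λ e e∈ → M′-window (M′⊆ e∈)))
                            (≤-trans (approx-bound isμ) (+-monoʳ-≤ (w M) εm≤)))
                          (+-monoʳ-≤ (w N′) (+-mono-≤ wD≤ wL≤)) ⟩
            (w M + ε * (S + S)) + (w N′ + ((ε * S + ε * S) + (ε * (S + S) + ε * (S + S))))
              ≈⟨ solve 4 (λ m ε s n → (m :+ ε :* (s :+ s)) :+ (n :+ ((ε :* s :+ ε :* s) :+ (ε :* (s :+ s) :+ ε :* (s :+ s))))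
                   := (n :+ numeral 8 :* (ε :* s)) :+ m) refl (w M) ε S (w N′) ⟩
            (w N′ + loss S) + w M ∎)
        k (N′ , N′-matching , (λ e∈ → keep-or-new (N′⊆ e∈)) , bound)

    -- Induction on the number of classes. An edge surviving from N lies in none of them, so once
    -- the classes cover all weights only edges of the M i remain.
    process : ∀ {k δ} → 1# < δ → (ℓ r : Fin k → Carrier) → Adjacent 0<ε 0<z εz≈1 ℓ r → (∀ i → δ * ℓ i ≤ r i) →
      (M : Fin k → EdgeSet) → (∀ i → IsApproxMWM ε (Window (ℓ i) (r i)) (M i)) →
      (c : Fin k → Edge → Carrier) → (∀ i e → Cost 0<ε 0<z εz≈1 (weight e) (ℓ i) (r i) (c i e)) →
      ∀ {N} → IsMatching N → (∀ i {e} → e ∈ N → r i * z ≤ weight e → e ∈ M*) →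
      ¬ ¬ (∃[ N′ ] (IsMatching N′ ×
        (∀ {e} → e ∈ N′ → (e ∈ N × (∀ i → ¬ Class (ℓ i) (r i) e)) ⊎ (∃[ i ] e ∈ M i)) ×
        w N ≤ w N′ + loss (sum (λ i → total (c i) M*))))
    process {ℕ.zero} 1<δ ℓ r adj wide M approx c cost {N} N-matching heavy k =
      k (N , N-matching , (λ e∈N → inj₁ (e∈N , λ ())) , x≤x+y (≤-reflexive (begin-equality
        0#                    ≈⟨ zeroʳ (8 · 1#) ⟨
        8 · 1# * 0#           ≈⟨ *-congˡ (zeroʳ ε) ⟨
        8 · 1# * (ε * 0#)     ∎)))
    process {ℕ.suc _} 1<δ ℓ r adj wide M approx c cost {N} N-matching heavy k = do
      (N₁ , N₁-matching , N₁⊆ , N≤N₁) ← Step.step N-matching (approx zero) (cost zero) (heavy zero)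
      let
        -- Edges of the first M weigh less than `r zero * z`, hence never lie above a later window:
        -- the invariant persists.
        M₀-light : ∀ i {e} → e ∈ M zero → r (suc i) * z ≤ weight e → e ∈ M*
        M₀-light i {e} e∈M₀ rz≤e = contradiction (begin-strict
          weight e          <⟨ proj₂ (proj₂ (proj₁ (approx zero)) e e∈M₀) ⟩
          r zero * z        ≤⟨ *-monoʳ-≤ (<⇒≤ 0<z) (r-increasing 0<ε 0<z εz≈1 1<δ (ℓ ∘ suc) (r ∘ suc)
                                 (adjacent-tail 0<ε 0<z εz≈1 adj) (wide ∘ suc)
                                 (0<r₀ e∈M₀) (adjacent-first 0<ε 0<z εz≈1 adj) i) ⟩
          r (suc i) * z     ∎) rz≤e
        heavy₁ : ∀ i {e} → e ∈ N₁ → r (suc i) * z ≤ weight e → e ∈ M*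
        heavy₁ i e∈N₁ = origin i (N₁⊆ e∈N₁) M₀-light
      (N₂ , N₂-matching , N₂⊆ , N₁≤N₂) ← process 1<δ (ℓ ∘ suc) (r ∘ suc) (adjacent-tail 0<ε 0<z εz≈1 adj) (wide ∘ suc)
        (M ∘ suc) (approx ∘ suc) (c ∘ suc) (cost ∘ suc) N₁-matching heavy₁
      k (N₂ , N₂-matching , (λ e∈N₂ → combine N₁⊆ (N₂⊆ e∈N₂)) , (begin
        w N                               ≤⟨ N≤N₁ ⟩
        w N₁ + loss S₀                    ≤⟨ +-monoˡ-≤ (loss S₀) N₁≤N₂ ⟩
        w N₂ + loss S₁ + loss S₀          ≈⟨ solve 5 (λ n E ε s t → n :+ E :* (ε :* t) :+ E :* (ε :* s)
                                               := n :+ E :* (ε :* (s :+ t))) refl (w N₂) (8 · 1#) ε S₀ S₁ ⟩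
        w N₂ + loss (S₀ + S₁)             ∎))
      where
      S₀ = total (c zero) M*
      S₁ = sum (λ i → total (c (suc i)) M*)
      0<r₀ : ∀ {e} → e ∈ M zero → 0# < r zero
      0<r₀ {e} e∈M₀ = begin-strict
        0#                 <⟨ *-pos 0<ε (<-trans (0<weight e) (proj₂ (proj₂ (proj₁ (approx zero)) e e∈M₀))) ⟩
        ε * (r zero * z)   ≈⟨ ε[xz]≈x 0<ε 0<z εz≈1 (r zero) ⟩
        r zero             ∎
      origin : ∀ i {e} → (e ∈ N × ¬ Class (ℓ zero) (r zero) e) ⊎ e ∈ M zero →
        (∀ i {e} → e ∈ M zero → r (suc i) * z ≤ weight e → e ∈ M*) → r (suc i) * z ≤ weight e → e ∈ M*
      origin i (inj₁ (e∈N , _)) _  = heavy (suc i) e∈N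
      origin i (inj₂ e∈M₀) M₀-light = M₀-light i e∈M₀
      combine : ∀ {N₁ e} →
        (∀ {e} → e ∈ N₁ → (e ∈ N × ¬ Class (ℓ zero) (r zero) e) ⊎ e ∈ M zero) →
        (e ∈ N₁ × (∀ i → ¬ Class (ℓ (suc i)) (r (suc i)) e)) ⊎ (∃[ i ] e ∈ M (suc i)) →
        (e ∈ N × (∀ i → ¬ Class (ℓ i) (r i) e)) ⊎ (∃[ i ] e ∈ M i)
      combine N₁⊆ (inj₂ (i , e∈M)) = inj₂ (suc i , e∈M)
      combine N₁⊆ (inj₁ (e∈N₁ , ¬cls)) with N₁⊆ e∈N₁
      ... | inj₁ (e∈N , ¬cls₀) = inj₁ (e∈N , λ { zero → ¬cls₀ ; (suc i) → ¬cls i })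
      ... | inj₂ e∈M = inj₂ (zero , e∈M)

-- Choice of the constants and conclusion.

∈⋃-tabulate : ∀ {n k} (M : Fin k → Subset n) i {e} → e ∈ M i → e ∈ ⋃ (tabulate M)
∈⋃-tabulate M zero    e∈M = x∈p∪q⁺ (inj₁ e∈M)
∈⋃-tabulate M (suc i) e∈M = x∈p∪q⁺ {p = M zero} (inj₂ (∈⋃-tabulate (M ∘ suc) i e∈M))

lemma3p2 : (ℝ : Reals) →
    let open Reals ℝ
        open WeightedMatching ℝ
        open WeightedGraph
    in
    -- The factor 1# ⊔ L is the logarithm when δ ≤ 1/ε; for δ > 1/ε a loss of
    -- order ε remains, however small the logarithm (already for k = 1).
    ∃[ C ] (0# < C ×
      (∀ (ε δ L : Carrier) (0<ε : 0# < ε) → 6 · ε ≤ 1# → 1# < δ →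
       IsLog δ (recip ε 0<ε) L →
       ∀ (W : Carrier) (G : WeightedGraph W) (k : ℕ) (ℓ r : Fin k → Carrier) →
       IsWeightPartition W ℓ r → IsWide δ ℓ r →
       ∀ (M : Fin k → EdgeSet G) →
       (∀ i → IsApproxMWM G ε (Restrict G (ε * ℓ i) (r i * recip ε 0<ε)) (M i)) →
       ∀ (μ∪ μG : Carrier) → Isμ G (Union G M) μ∪ → Isμ G U μG →
       (1# - C * (ε * (1# ⊔ L))) * μG ≤ μ∪))
lemma3p2 ℝ = constant , 0<constant , main
  where
  open Reals ℝ hiding (zero)
  open OrderedField ℝ
  open Costs ℝ
  open WeightedMatching ℝ
  open ≤-Reasoning

  -- 8 is the factor in `loss`; 18 comes from `collect`.
  constant : Carrier
  constant = 8 · 1# * 18 · 1#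

  0<·1 : ∀ n → 0# < ℕ.suc n · 1#
  0<·1 n = <-≤-trans 0<1 (x≤x+y (·1-nonneg n))

  0<constant : 0# < constant
  0<constant = *-pos (0<·1 7) (0<·1 17)

  -- Counting down from an archimedean bound stops at 0 or at some n below L + 1, and 1 and L are
  -- both at most 1# ⊔ L.
  ceiling : ∀ L → ¬ ¬ (∃[ n ] (L ≤ n · 1# × n · 1# ≤ (1# ⊔ L) + (1# ⊔ L)))
  ceiling L k = let (n , L<n) = archimedean L in search n (<⇒≤ L<n)
    where
    1≤Λ : 1# ≤ 1# ⊔ L
    1≤Λ = proj₁ (⊔-supremum 1# L)
    L≤Λ : L ≤ 1# ⊔ L
    L≤Λ = proj₁ (proj₂ (⊔-supremum 1# L))
    0≤Λ = ≤-trans (<⇒≤ 0<1) 1≤Λ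
    search : ∀ n → L ≤ n · 1# → ⊥
    search ℕ.zero    L≤n = k (0 , L≤n , +-nonneg 0≤Λ 0≤Λ)
    search (ℕ.suc n) L≤n = do
      inj₁ n<L ← ≤-split (n · 1#) L
        where inj₂ L≤n → search n L≤n
      k (ℕ.suc n , L≤n , +-mono-≤ 1≤Λ (≤-trans (<⇒≤ n<L) L≤Λ))

  main : let open WeightedGraph in
    ∀ (ε δ L : Carrier) (0<ε : 0# < ε) → 6 · ε ≤ 1# → 1# < δ →
    IsLog δ (recip ε 0<ε) L →
    ∀ (W : Carrier) (G : WeightedGraph W) (k : ℕ) (ℓ r : Fin k → Carrier) →
    IsWeightPartition W ℓ r → IsWide δ ℓ r →
    ∀ (M : Fin k → EdgeSet G) →
    (∀ i → IsApproxMWM G ε (Restrict G (ε * ℓ i) (r i * recip ε 0<ε)) (M i)) →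
    ∀ (μ∪ μG : Carrier) → Isμ G (Union G M) μ∪ → Isμ G U μG →
    (1# - constant * (ε * (1# ⊔ L))) * μG ≤ μ∪
  main ε δ L 0<ε 6ε≤1 1<δ isLog W G k ℓ r partition wide M approx μ∪ μG isμ∪ isμG μ∪< = do
    (M* , (M*-matching , _) , wM*≈μG) ← proj₂ isμG
    (K , L≤K , K≤2Λ) ← ceiling L
    c-data ← ¬¬-∀Fin λ i → ¬¬-∀Fin λ e → cost-exists 0<ε 0<z εz≈1 (weight e) (ℓ i) (r i)
    let
      M*-optimal : ∀ N → IsMatching N → w N ≤ w M*
      M*-optimal N N-matching = ≤-trans (proj₁ isμG N (N-matching , λ _ _ → tt)) (≤-reflexive (sym wM*≈μG))
      c : Fin k → Edge → Carrier
      c i e = proj₁ (c-data i e)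
    -- The process starts from M* itself, where the invariant is trivial.
    (N , N-matching , N⊆ , M*≤) ← Composition.process ℝ G 0<ε 0<z ε≤1 1≤z εz≈1 M*-matching M*-optimal
      1<δ ℓ r adjacent wide M approx c (λ i e → proj₂ (c-data i e)) M*-matching (λ _ e∈M* _ → e∈M*)
    let
      N-in-union : ∀ e → e ∈ N → Union M e
      N-in-union e e∈N = decidable-stable (e ∈? ⋃ (tabulate M)) λ e∉ → do
        -- By coverage e lies in some class, so it is not a leftover of M*.
        (i , e∈class) ← covers (weight e) (1≤weight e) (weight≤W e)
        in-union e∉ e∈class (N⊆ e∈N)
      -- Costs are regrouped by optimal edge. With κ = 2 K and m = 3 K, both requirements of
      -- `cost-sum` follow from 2 ≤ z ≤ δ ^ K.
      Σc≤ : sum (λ i → total (c i) M*) ≤ 18 · 1# * Λ * w M*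
      Σc≤ = begin
        sum (λ i → total (c i) M*)                 ≈⟨ total-sum c M* ⟩
        total (λ e → sum (λ i → c i e)) M*         ≤⟨ total-mono (λ e → ≤-trans
            (cost-sum 0<ε 0<z εz≈1 1<δ (+-nonneg (·1-nonneg K) (·1-nonneg K))
               (series-bound δ K 1<δ (≤-trans 2≤z (z≤δ^ K L≤K))) (K ℕ.+ (K ℕ.+ K)) (2z²≤ K L≤K)
               ℓ r (λ i → c i e) adjacent wide (λ i → proj₂ (c-data i e)) (0<weight e))
            (collect K K≤2Λ (0≤weight e))) M* ⟩
        total (λ e → 18 · 1# * Λ * weight e) M*    ≈⟨ total-scale (18 · 1# * Λ) weight M* ⟩
        18 · 1# * Λ * w M*                         ∎
    final (begin
      μG                                              ≈⟨ wM*≈μG ⟨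
      w M*                                            ≤⟨ M*≤ ⟩
      w N + 8 · 1# * (ε * sum (λ i → total (c i) M*)) ≤⟨ +-mono-≤ (proj₁ isμ∪ N (N-matching , N-in-union))
                                                          (*-monoˡ-≤ (·1-nonneg 8) (*-monoˡ-≤ 0≤ε Σc≤)) ⟩
      μ∪ + 8 · 1# * (ε * (18 · 1# * Λ * w M*))        ≈⟨ +-congˡ (*-congˡ (*-congˡ (*-congˡ wM*≈μG))) ⟩
      μ∪ + 8 · 1# * (ε * (18 · 1# * Λ * μG))          ≈⟨ solve 6 (λ u E ε F Λ g → u :+ E :* (ε :* (F :* Λ :* g))
                                                          := u :+ E :* F :* (ε :* Λ) :* g) refl
                                                          μ∪ (8 · 1#) ε (18 · 1#) Λ μG ⟩
      μ∪ + constant * (ε * Λ) * μG                    ∎)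
    where
    open WeightedGraph G
    open Matchings ℝ G using (0<weight; 0≤weight)
    open IsWeightPartition partition using (covers; adjacent)
    z = recip ε 0<ε
    Λ = 1# ⊔ L
    0≤ε = <⇒≤ 0<ε
    1≤Λ : 1# ≤ Λ
    1≤Λ = proj₁ (⊔-supremum 1# L)

    εz≈1 : ε * z ≈ 1#
    -- Apartness from 0 inverts ε minus 0, hence the correction by `x-0≈x`.
    εz≈1 = trans (*-congʳ (sym (x-0≈x ε))) (proj₂ (proj₂ (#⇒invertible (#-sym (<⇒# 0<ε)))))

    2ε≤1 : ε + ε ≤ 1#
    2ε≤1 = begin
      ε + ε              ≤⟨ x≤x+y (+-nonneg (+-nonneg 0≤ε 0≤ε) (+-nonneg 0≤ε 0≤ε)) ⟩
      (ε + ε) + ((ε + ε) + (ε + ε))  ≈⟨ solve 1 (λ ε → (ε :+ ε) :+ ((ε :+ ε) :+ (ε :+ ε))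
                              := ε :+ (ε :+ (ε :+ (ε :+ (ε :+ (ε :+ con 0)))))) refl ε ⟩
      6 · ε              ≤⟨ 6ε≤1 ⟩
      1#                 ∎

    ε≤1 : ε ≤ 1#
    ε≤1 = ≤-trans (x≤x+y 0≤ε) 2ε≤1

    0<z : 0# < z
    0<z with #⇒<⊎> (invertible⇒# {z} {0#} (ε , trans (*-congˡ (x-0≈x z)) εz≈1 , trans (*-congʳ (x-0≈x z)) (trans (*-comm z ε) εz≈1)))
    ... | inj₂ 0<z = 0<z
    ... | inj₁ z<0 = contradiction (begin-strict
      1#       ≈⟨ εz≈1 ⟨
      ε * z    <⟨ *-monoˡ-< 0<ε z<0 ⟩
      ε * 0#   ≈⟨ zeroʳ ε ⟩
      0#       ∎) (<⇒≤ 0<1)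

    2≤z : 1# + 1# ≤ z
    2≤z = begin
      1# + 1#          ≈⟨ +-cong εz≈1 εz≈1 ⟨
      ε * z + ε * z    ≈⟨ distribʳ z ε ε ⟨
      (ε + ε) * z      ≤⟨ *-monoʳ-≤ (<⇒≤ 0<z) 2ε≤1 ⟩
      1# * z           ≈⟨ *-identityˡ z ⟩
      z                ∎

    1≤z : 1# ≤ z
    1≤z = ≤-trans (x≤x+y (<⇒≤ 0<1)) 2≤z

    z≤δ^ : ∀ K → L ≤ K · 1# → z ≤ δ ^ K
    z≤δ^ K L≤K = begin
      z              ≈⟨ trans (*-identityʳ (z * 1#)) (*-identityʳ z) ⟨
      -- p = K and p′ = q = 0 select the integer exponent K.
      z * 1# * 1#    ≤⟨ proj₂ (isLog K 0 0) (≤-trans (≤-reflexive (trans (+-identityʳ (L + 0#)) (+-identityʳ L))) L≤K) ⟩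
      δ ^ K          ∎

    2z²≤ : ∀ K → L ≤ K · 1# → z * z + z * z ≤ δ ^ (K ℕ.+ (K ℕ.+ K))
    2z²≤ K L≤K = begin
      z * z + z * z              ≈⟨ solve 1 (λ z → z :* z :+ z :* z := (con 1 :+ con 1) :* (z :* z)) refl z ⟩
      (1# + 1#) * (z * z)        ≤⟨ *-mono-≤ (+-nonneg (<⇒≤ 0<1) (<⇒≤ 0<1)) (*-nonneg 0≤q 0≤q) (≤-trans 2≤z z≤q)
                                      (*-mono-≤ (<⇒≤ 0<z) 0≤q z≤q z≤q) ⟩
      q * (q * q)                ≈⟨ trans (^-homo-* δ K (K ℕ.+ K)) (*-congˡ (^-homo-* δ K K)) ⟨
      δ ^ (K ℕ.+ (K ℕ.+ K))      ∎
      where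
      q = δ ^ K
      z≤q = z≤δ^ K L≤K
      0≤q : 0# ≤ q
      0≤q = ≤-trans (<⇒≤ 0<z) z≤q

    -- 2 K from the low costs, 2 from the first class that is not low and 2 for each of 3 K more: 8
    -- K + 2 ≤ 18 Λ, as K ≤ 2 Λ and 1 ≤ Λ.
    collect : ∀ K → K · 1# ≤ Λ + Λ → ∀ {y} → 0# ≤ y →
      (K · 1# + K · 1#) * y + ((y + y) + (K ℕ.+ (K ℕ.+ K)) · 1# * (y + y)) ≤ 18 · 1# * Λ * y
    collect K K≤2Λ {y} 0≤y = begin
      (κ + κ) * y + ((y + y) + (K ℕ.+ (K ℕ.+ K)) · 1# * (y + y))
        ≈⟨ +-congˡ (+-congˡ (*-congʳ (trans (×-homo-+ 1# K (K ℕ.+ K)) (+-congˡ (×-homo-+ 1# K K))))) ⟩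
      (κ + κ) * y + ((y + y) + (κ + (κ + κ)) * (y + y))
        ≈⟨ solve 2 (λ κ y → (κ :+ κ) :* y :+ ((y :+ y) :+ (κ :+ (κ :+ κ)) :* (y :+ y))
             := (numeral 8 :* κ :+ numeral 2) :* y) refl κ y ⟩
      (8 · 1# * κ + 2 · 1#) * y
        ≤⟨ *-monoʳ-≤ 0≤y (+-mono-≤ (*-monoˡ-≤ (·1-nonneg 8) K≤2Λ) 2≤2Λ) ⟩
      (8 · 1# * (Λ + Λ) + (Λ + Λ)) * y
        ≈⟨ solve 2 (λ Λ y → (numeral 8 :* (Λ :+ Λ) :+ (Λ :+ Λ)) :* y := numeral 18 :* Λ :* y) refl Λ y ⟩
      18 · 1# * Λ * y   ∎
      where
      κ = K · 1#
      2≤2Λ : 2 · 1# ≤ Λ + Λ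
      2≤2Λ = +-mono-≤ 1≤Λ (≤-trans (≤-reflexive (+-identityʳ 1#)) 1≤Λ)

    in-union : ∀ {e i} {N : Subset #edges} → e ∉ ⋃ (tabulate M) → weight e ∈[ ℓ i , r i ⟩ →
      (e ∈ N × (∀ i → ¬ (weight e ∈[ ℓ i , r i ⟩))) ⊎ (∃[ i ] e ∈ M i) → ⊥
    in-union e∉ e∈class (inj₁ (_ , ¬class)) = ¬class _ e∈class
    in-union e∉ e∈class (inj₂ (i , e∈M))    = e∉ (∈⋃-tabulate M i e∈M)

    final : ¬ (μG ≤ μ∪ + constant * (ε * Λ) * μG)
    final μG≤ = +-cancelʳ-≤ (constant * (ε * Λ) * μG) (begin
      (1# - x) * μG + x * μG   ≈⟨ distribʳ μG (1# - x) x ⟨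
      (1# - x + x) * μG        ≈⟨ *-congʳ (trans (+-assoc 1# (- x) x) (trans (+-congˡ (-‿inverseˡ x)) (+-identityʳ 1#))) ⟩
      1# * μG                  ≈⟨ *-identityˡ μG ⟩
      μG                       ≤⟨ μG≤ ⟩
      μ∪ + x * μG              ∎) μ∪<
      where x = constant * (ε * Λ)
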